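{- \textsc{Long Choice} is PPP-hard: \textsc{Collision} polynomial-time reduces to \textsc{Long Choice}.
   Context: All circuits are Boolean circuits of size polynomial in $n$; $n$-bit strings are identified with integers in $[0,2^n-1]$. A search problem $A$ polynomial-time reduces to a search problem $B$ if there are polynomial-time computable maps $f,g$ such that for every instance $I$ of $A$, $f(I)$ is an instance of $B$, and for every solution $s$ of $f(I)$, $g(I,s)$ is a solution of $I$. \textsc{Collision}: given a poly($n$)-size circuit $C:\{0,1\}^n\to\{0,1\}^n$, find either $x$ with $C(x)=0^n$, or $x\neq y$ with $C(x)=C(y)$. PPP is the class of search problems polynomial-time reducible to \textsc{Collision}; a problem is PPP-hard if \textsc{Collision} reduces to it. \textsc{Long Choice}: Let $U=\{0,1\}^n$. The input is a sequence of predicates $P_0,\dots,P_{n-2}$ given by poly($n$)-size circuits, $P_i:U^{i+2}\to\{0,1\}$. A solution is a sequence of $n+1$ distinct elements $a_0,\dots,a_n\in U$ such that for every $i\in\{0,\dots,n-2\}$, $P_i(a_0,\dots,a_i,a_j)$ is the same for all $j>i$. -}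

module Defs where

open import Data.Bool.Base using (Bool; true; false; _∧_; _∨_; not)
open import Data.Fin.Base using (Fin; toℕ)
open import Data.Fin.Properties using (toℕ<n)
open import Data.Nat.Base using (ℕ; zero; suc; _+_; _*_; _∸_; _^_; _≤_; _<_)
open import Data.Nat.Properties using (≤-trans; m∸n≤m; n≤1+n)
open import Data.Product.Base using (Σ; ∃-syntax; _×_; _,_)
open import Data.Vec.Base
  using (Vec; []; _∷_; _∷ʳ_; concat; head; lookup; map; replicate; tabulate; truncate)
open import Function.Definitions using (Injective)
open import Relation.Binary.PropositionalEquality using (_≡_; _≢_)

-- The machine model is a small while-language over binary trees, in the
-- style of Jones's WHILE.  Booleans in tests: `nil` is false, any other
-- tree is true.

infixr 5 _∙_

data Tree : Set where
  nil : Tree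
  _∙_ : Tree → Tree → Tree

size : Tree → ℕ
size nil     = 1
size (s ∙ t) = suc (size s + size t)

infixr 4 _⨾_

data Prog : Set where
  id′ hd tl nil′ : Prog
  _⨾_            : Prog → Prog → Prog
  ⟨_,_⟩          : Prog → Prog → Prog
  if_then_else_  : Prog → Prog → Prog → Prog
  while_run_     : Prog → Prog → Prog

left right : Tree → Tree
left  nil     = nil
left  (s ∙ t) = s
right nil     = nil
right (s ∙ t) = t

-- p ⊢ x ⇓ y [ t ] : on input x, program p halts with output y at cost t.
-- Every elementary operation, including each copy of the input made by a
-- pairing or a test, is charged the full size of the tree it handles.  The
-- cost therefore bounds the number of steps and the size of every
-- intermediate tree, so polynomial cost here is polynomial time on Turing
-- machines and conversely.
infix 3 _⊢_⇓_[_]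

data _⊢_⇓_[_] : Prog → Tree → Tree → ℕ → Set where
  ⇓id  : ∀ {x} → id′ ⊢ x ⇓ x [ size x ]
  ⇓hd  : ∀ {x} → hd ⊢ x ⇓ left x [ size x ]
  ⇓tl  : ∀ {x} → tl ⊢ x ⇓ right x [ size x ]
  ⇓nil : ∀ {x} → nil′ ⊢ x ⇓ nil [ size x ]
  ⇓seq : ∀ {p q x y z s t} →
         p ⊢ x ⇓ y [ s ] → q ⊢ y ⇓ z [ t ] →
         p ⨾ q ⊢ x ⇓ z [ s + t ]
  ⇓pair : ∀ {p q x y z s t} →
          p ⊢ x ⇓ y [ s ] → q ⊢ x ⇓ z [ t ] →
          ⟨ p , q ⟩ ⊢ x ⇓ y ∙ z [ size x + (s + t) ]
  ⇓then : ∀ {b p q x u v y s t} →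
          b ⊢ x ⇓ u ∙ v [ s ] → p ⊢ x ⇓ y [ t ] →
          if b then p else q ⊢ x ⇓ y [ size x + (s + t) ]
  ⇓else : ∀ {b p q x y s t} →
          b ⊢ x ⇓ nil [ s ] → q ⊢ x ⇓ y [ t ] →
          if b then p else q ⊢ x ⇓ y [ size x + (s + t) ]
  ⇓stop : ∀ {b p x s} →
          b ⊢ x ⇓ nil [ s ] →
          while b run p ⊢ x ⇓ x [ size x + s ]
  ⇓loop : ∀ {b p x u v y z s t r} →
          b ⊢ x ⇓ u ∙ v [ s ] → p ⊢ x ⇓ y [ t ] → while b run p ⊢ y ⇓ z [ r ] →
          while b run p ⊢ x ⇓ z [ size x + (s + t + r) ]

-- A map is given by the encodings of its arguments and of its values.
-- Since size x ≥ 1, the bounds c · (size x)^d dominate all polynomials.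
PolyTime : {X : Set} → (X → Tree) → (X → Tree) → Set
PolyTime {X} inp out =
  ∃[ p ] ∃[ c ] ∃[ d ]
    ((x : X) → ∃[ t ] (p ⊢ inp x ⇓ out x [ t ] × t ≤ c * size (inp x) ^ d))

record SearchProblem : Set₁ where
  field
    Instance  : Set
    Candidate : Instance → Set
    Solution  : (I : Instance) → Candidate I → Set
    encI      : Instance → Tree
    encC      : (I : Instance) → Candidate I → Tree

open SearchProblem

record Reduction (A B : SearchProblem) : Set where
  field
    f       : Instance A → Instance B
    g       : (I : Instance A) → Candidate B (f I) → Candidate A I
    f-poly  : PolyTime (encI A) (λ I → encI B (f I))
    g-poly  : PolyTime {Σ (Instance A) λ I → Candidate B (f I)}
                (λ (I , s) → encI A I ∙ encC B (f I) s)
                (λ (I , s) → encC A I (g I s))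
    correct : (I : Instance A) (s : Candidate B (f I)) →
              Solution B (f I) s → Solution A I (g I s)

-- A problem whose circuits have size poly(n) is a family of search problems,
-- one for each polynomial bound n^k + k on the circuit size.
Problem : Set₁
Problem = ℕ → SearchProblem

_≤ᴾ_ : Problem → Problem → Set
A ≤ᴾ B = ∀ k → ∃[ l ] Reduction (A k) (B l)

-- Gate w reads from w existing wires.
data Gate (w : ℕ) : Set where
  const   : Bool → Gate w
  neg     : Fin w → Gate w
  and or  : Fin w → Fin w → Gate w

-- Straight-line list of gates extending w wires to w′ wires.  Each new wire
-- is put in front of the existing ones: index 0 is the most recent wire.
data Gates : ℕ → ℕ → Set where
  []  : ∀ {w} → Gates w w
  _∷_ : ∀ {w w′} → Gate w → Gates (suc w) w′ → Gates w w′

record Circuit (m o : ℕ) : Set where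
  constructor circuit
  field
    {wires} : ℕ
    gates   : Gates m wires
    outputs : Vec (Fin wires) o

open Circuit

evalGate : ∀ {w} → Gate w → Vec Bool w → Bool
evalGate (const b) v = b
evalGate (neg i)   v = not (lookup v i)
evalGate (and i j) v = lookup v i ∧ lookup v j
evalGate (or i j)  v = lookup v i ∨ lookup v j

evalGates : ∀ {w w′} → Gates w w′ → Vec Bool w → Vec Bool w′
evalGates []       v = v
evalGates (g ∷ gs) v = evalGates gs (evalGate g v ∷ v)

eval : ∀ {m o} → Circuit m o → Vec Bool m → Vec Bool o
eval C x = map (lookup (evalGates (gates C) x)) (outputs C)

gateCount : ∀ {w w′} → Gates w w′ → ℕ
gateCount []       = 0
gateCount (g ∷ gs) = suc (gateCount gs)

circuitSize : ∀ {m o} → Circuit m o → ℕ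
circuitSize C = gateCount (gates C)

-- Numbers, including wire indices, are encoded in unary.  This is polynomially
-- equivalent to binary: an instance with parameter n already lists n outputs
-- or n - 1 circuits, and indices are below the number of inputs plus gates.

encℕ : ℕ → Tree
encℕ zero    = nil
encℕ (suc n) = nil ∙ encℕ n

encBool : Bool → Tree
encBool false = nil
encBool true  = nil ∙ nil

encVec : ∀ {A : Set} {n} → (A → Tree) → Vec A n → Tree
encVec enc []       = nil
encVec enc (x ∷ xs) = enc x ∙ encVec enc xs

encFin : ∀ {n} → Fin n → Tree
encFin i = encℕ (toℕ i)

encGate : ∀ {w} → Gate w → Tree
encGate (const b) = encℕ 0 ∙ encBool b
encGate (neg i)   = encℕ 1 ∙ encFin i
encGate (and i j) = encℕ 2 ∙ encFin i ∙ encFin j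
encGate (or i j)  = encℕ 3 ∙ encFin i ∙ encFin j

encGates : ∀ {w w′} → Gates w w′ → Tree
encGates []       = nil
encGates (g ∷ gs) = encGate g ∙ encGates gs

encCircuit : ∀ {m o} → Circuit m o → Tree
encCircuit C = encGates (gates C) ∙ encVec encFin (outputs C)

U : ℕ → Set
U n = Vec Bool n

encU : ∀ {n} → U n → Tree
encU = encVec encBool

record CollisionInstance (k : ℕ) : Set where
  field
    n     : ℕ
    C     : Circuit n n
    small : circuitSize C ≤ n ^ k + k

data CollisionCandidate (n : ℕ) : Set where
  preimage  : (x : U n) → CollisionCandidate n
  collision : (x y : U n) → CollisionCandidate n

CollisionSolution : ∀ {n} → Circuit n n → CollisionCandidate n → Set
CollisionSolution {n} C (preimage x)    = eval C x ≡ replicate n false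
CollisionSolution     C (collision x y) = x ≢ y × eval C x ≡ eval C y

encCollisionCandidate : ∀ {n} → CollisionCandidate n → Tree
encCollisionCandidate (preimage x)    = encBool false ∙ encU x
encCollisionCandidate (collision x y) = encBool true ∙ encU x ∙ encU y

Collision : Problem
Collision k = record
  { Instance  = CollisionInstance k
  ; Candidate = λ I → CollisionCandidate (n I)
  ; Solution  = λ I → CollisionSolution (C I)
  ; encI      = λ I → encℕ (n I) ∙ encCircuit (C I)
  ; encC      = λ I → encCollisionCandidate
  }
  where open CollisionInstance

PPP-Hard : Problem → Set
PPP-Hard B = Collision ≤ᴾ B

-- P i reads i + 2 elements of U n, concatenated in order.
Predicates : ℕ → Set
Predicates n = (i : Fin (n ∸ 1)) → Circuit ((2 + toℕ i) * n) 1

record LongChoiceInstance (k : ℕ) : Set where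
  field
    n     : ℕ
    P     : Predicates n
    small : ∀ i → circuitSize (P i) ≤ n ^ k + k

-- a₀ , … , aᵢ
prefix : ∀ {n} {A : Set} → Vec A (suc n) → (i : Fin (n ∸ 1)) → Vec A (1 + toℕ i)
prefix {n} a i =
  truncate (≤-trans (toℕ<n i) (≤-trans (m∸n≤m n 1) (n≤1+n n))) a

-- Pᵢ (a₀ , … , aᵢ , aⱼ)
valueAt : ∀ {n} → Predicates n → Vec (U n) (suc n) → Fin (n ∸ 1) → Fin (suc n) → Bool
valueAt P a i j = head (eval (P i) (concat (prefix a i ∷ʳ lookup a j)))

LongChoiceSolution : ∀ {n} → Predicates n → Vec (U n) (suc n) → Set
LongChoiceSolution {n} P a =
  Injective _≡_ _≡_ (lookup a) ×
  (∀ (i : Fin (n ∸ 1)) (j j′ : Fin (suc n)) →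
     toℕ i < toℕ j → toℕ i < toℕ j′ → valueAt P a i j ≡ valueAt P a i j′)

LongChoice : Problem
LongChoice k = record
  { Instance  = LongChoiceInstance k
  ; Candidate = λ I → Vec (U (n I)) (suc (n I))
  ; Solution  = λ I → LongChoiceSolution (P I)
  ; encI      = λ I → encℕ (n I) ∙ encVec (λ t → t) (tabulate λ i → encCircuit (P I i))
  ; encC      = λ I → encVec encU
  }
  where open LongChoiceInstance

{-# OPTIONS --safe #-}

-- Let y_s = C(a_s), and suppose that the y_s are nonzero and distinct.  Keep a
-- hole H_i that is no later value: H_0 = 0, and H_i is 0 or some y_r with
-- r < i.  Let p be the last position where H_i and y_i differ, and let
-- P_i (a_0, …, a_i, x) tell whether C(x) differs from H_i at p.  The next hole
-- is whichever of H_i and y_i agrees with y_{i+1} at p.  By induction, all y_j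
-- with j ≥ i agree with H_i on i distinct positions, so y_n = H_n, which is
-- absurd.  Hence the values of C on any solution contain zero or a repetition,
-- which is found by trying all pairs.
--
-- The circuits of the P_i consist of repetitions of single gates with constant
-- indices: such a repetition computes a whole block of n wires from older
-- blocks.  Both maps of the reduction are composed from a few loops over lists
-- whose running times are polynomially bounded once and for all.

module Submission where

open import Data.Bool.Base using (Bool; true; false; _∧_; _∨_; not)
open import Data.Bool.Properties using (∨-zeroʳ; ∧-zeroʳ; ∨-identityʳ; ∧-identityʳ; ∨-idem)
  renaming (_≟_ to _≟ᵇ_)
open import Data.Empty using (⊥; ⊥-elim)
open import Data.Fin.Base using (Fin; toℕ; fromℕ<; zero; suc)
open import Data.Fin.Properties using (toℕ-fromℕ<; toℕ<n; injective⇒≤; suc-injective)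
open import Data.List.Base using (List; []; _∷_; _++_; length; replicate; [_])
open import Data.List.Properties using (length-++; length-replicate)
open import Data.List.Relation.Unary.All as ListAll using ([]; _∷_)
open import Data.Nat.Base hiding (equal)
open import Data.Nat.Properties hiding (suc-injective)
open import Data.Nat.Tactic.RingSolver using (solve-∀)
open import Data.Product.Base using (Σ; ∃-syntax; _×_; _,_; proj₁; proj₂)
open import Data.Sum.Base using (_⊎_; inj₁; inj₂)
open import Data.Unit.Base using (⊤; tt)
open import Data.Vec.Base as Vec
  using (Vec; []; _∷_; _∷ʳ_; lookup; map; tabulate; concat; truncate; head)
open import Data.Vec.Properties using (lookup-map; lookup-replicate; tabulate-cong)
open import Data.Vec.Relation.Unary.All as All using (All; []; _∷_)
open import Data.Vec.Relation.Unary.Unique.Propositional using (Unique; []; _∷_)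
open import Data.Vec.Relation.Unary.Unique.Propositional.Properties using (lookup-injective)
open import Function.Definitions using (Injective)
open import Relation.Binary.Definitions using (tri<; tri≈; tri>)
open import Relation.Binary.PropositionalEquality hiding ([_])
open import Relation.Nullary.Decidable using (Dec; yes; no; toWitness; _×-dec_)
open import Relation.Nullary.Negation.Core using (¬_)
open import Defs

open Circuit using (gates; outputs)

-- Polynomial-time functions on trees

-- The strings that agree with `H_i` on the chosen positions form a subcube. It holds all later
-- values and also one string, the hole, that none of them takes. Each step fixes one more
-- coordinate, so that after `n` steps the hole alone would be left. Tracking one unoccupied string
-- replaces counting how many values lie in a subcube, which small circuits are not known to do.
-- `H_i` depends only on `y_0, …, y_i`, so the circuit of `P_i` can recompute it from its arguments.
-- The positions are distinct for free: `y_i` itself agrees with `H_i` on the old ones, so the two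
-- differ elsewhere. There are `n` steps but only `n - 1` predicates; in the last step `y_n` is the
-- only later value, and constancy is automatic. The last difference is taken because new wires
-- enter at the front: a block is built from its last bit to its first, and one repeated gate
-- computes whether a true bit lies above each position.

size>0 : ∀ x → 0 < size x
size>0 nil     = s≤s z≤n
size>0 (_ ∙ _) = s≤s z≤n

size-pow : ∀ x {d e} → d ≤ e → size x ^ d ≤ size x ^ e
size-pow x = ^-monoʳ-≤ (size x) {{>-nonZero (size>0 x)}}

left≤ : ∀ x → size (left x) ≤ size x
left≤ nil     = ≤-refl
left≤ (s ∙ t) = m≤n⇒m≤1+n (m≤m+n _ _)

right≤ : ∀ x → size (right x) ≤ size x
right≤ nil     = ≤-refl
right≤ (s ∙ t) = m≤n⇒m≤1+n (m≤n+m _ _)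

-- Every rule charges at least what it builds; the new node of a pair is paid for by `size x`, which
-- is at least 1. A time bound thus also bounds the output, which is what lets time bounds compose.
output≤cost : ∀ {p x y t} → p ⊢ x ⇓ y [ t ] → size y ≤ t
output≤cost ⇓id = ≤-refl
output≤cost {x = x} ⇓hd = left≤ x
output≤cost {x = x} ⇓tl = right≤ x
output≤cost {x = x} ⇓nil = size>0 x
output≤cost (⇓seq p q) = ≤-trans (output≤cost q) (m≤n+m _ _)
output≤cost {x = x} (⇓pair p q) =
  +-mono-≤ (size>0 x) (+-mono-≤ (output≤cost p) (output≤cost q))
output≤cost {x = x} (⇓then {s = s} {t} b p) =
  ≤-trans (output≤cost p) (≤-trans (m≤n+m t s) (m≤n+m _ (size x)))
output≤cost {x = x} (⇓else {s = s} {t} b q) =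
  ≤-trans (output≤cost q) (≤-trans (m≤n+m t s) (m≤n+m _ (size x)))
output≤cost {x = x} (⇓stop b) = m≤m+n _ _
output≤cost {x = x} (⇓loop {s = s} {t} {r} b p w) =
  ≤-trans (output≤cost w) (≤-trans (m≤n+m r (s + t)) (m≤n+m _ (size x)))

PolyBounded : (Tree → ℕ) → Set
PolyBounded f = ∃[ c ] ∃[ d ] ∀ x → f x ≤ c * size x ^ d

module _ {f g : Tree → ℕ} where

  bounded-mono : PolyBounded g → (∀ x → f x ≤ g x) → PolyBounded f
  bounded-mono (c , d , h) f≤g = c , d , λ x → ≤-trans (f≤g x) (h x)

  bounded-+ : PolyBounded f → PolyBounded g → PolyBounded (λ x → f x + g x)
  bounded-+ (c , d , h) (c′ , d′ , h′) = c + c′ , d + d′ , λ x → begin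
    f x + g x                                            ≤⟨ +-mono-≤ (h x) (h′ x) ⟩
    c * size x ^ d + c′ * size x ^ d′                    ≤⟨ +-mono-≤ (*-monoʳ-≤ c (size-pow x (m≤m+n d d′)))
                                                                     (*-monoʳ-≤ c′ (size-pow x (m≤n+m d′ d))) ⟩
    c * size x ^ (d + d′) + c′ * size x ^ (d + d′)       ≡⟨ *-distribʳ-+ _ c c′ ⟨
    (c + c′) * size x ^ (d + d′)                         ∎
    where open ≤-Reasoning

  bounded-* : PolyBounded f → PolyBounded g → PolyBounded (λ x → f x * g x)
  bounded-* (c , d , h) (c′ , d′ , h′) = c * c′ , d + d′ , λ x → begin
    f x * g x                                ≤⟨ *-mono-≤ (h x) (h′ x) ⟩
    (c * size x ^ d) * (c′ * size x ^ d′)    ≡⟨ swap c (size x ^ d) c′ (size x ^ d′) ⟩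
    c * c′ * (size x ^ d * size x ^ d′)      ≡⟨ cong (c * c′ *_) (^-distribˡ-+-* (size x) d d′) ⟨
    c * c′ * size x ^ (d + d′)               ∎
    where
      open ≤-Reasoning
      swap : ∀ a b c d → (a * b) * (c * d) ≡ a * c * (b * d)
      swap = solve-∀

bounded-const : ∀ k → PolyBounded (λ _ → k)
bounded-const k = k , 0 , λ x → ≤-reflexive (sym (*-identityʳ k))

bounded-size : PolyBounded size
bounded-size = 1 , 1 , λ x → ≤-reflexive (sym (trans (*-identityˡ _) (*-identityʳ _)))

bounded-^ : ∀ {f} d → PolyBounded f → PolyBounded (λ x → f x ^ d)
bounded-^ zero    h = bounded-const 1
bounded-^ (suc d) h = bounded-* h (bounded-^ d h)

bounded-∘ : ∀ {f} (h : Tree → Tree) → PolyBounded (λ x → size (h x)) → PolyBounded f →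
            PolyBounded (λ x → f (h x))
bounded-∘ h bd (c , d , le) =
  bounded-mono (bounded-* (bounded-const c) (bounded-^ d bd)) (λ x → le (h x))

-- The program is bundled with the tree function that it computes, so that the correctness of a
-- composite is an equation between functions and often holds by computation. All bounds concern
-- arbitrary trees, not just encodings, so the combinators have no side conditions on their inputs.
record FP : Set where
  constructor mkFP
  field
    fun  : Tree → Tree
    prog : Prog
    time : Tree → ℕ
    run  : ∀ x → prog ⊢ x ⇓ fun x [ time x ]
    time-bounded : PolyBounded time

  fun-bounded : PolyBounded (λ x → size (fun x))
  fun-bounded = bounded-mono time-bounded (λ x → output≤cost (run x))

open FP public

FP⇒PolyTime : ∀ {X : Set} {inp out : X → Tree} (p : FP) →
              (∀ x → fun p (inp x) ≡ out x) → PolyTime inp out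
FP⇒PolyTime {inp = inp} p eq with time-bounded p
... | c , d , h = prog p , c , d , λ x →
  time p (inp x) , subst (prog p ⊢ inp x ⇓_[ time p (inp x) ]) (eq x) (run p (inp x)) , h (inp x)

ifᵗ : Tree → Tree → Tree → Tree
ifᵗ nil     s t = t
ifᵗ (_ ∙ _) s t = s

idᶠ hdᶠ tlᶠ nilᶠ : FP
idᶠ  = mkFP (λ x → x) id′ size (λ _ → ⇓id) bounded-size
hdᶠ  = mkFP left hd size (λ _ → ⇓hd) bounded-size
tlᶠ  = mkFP right tl size (λ _ → ⇓tl) bounded-size
nilᶠ = mkFP (λ _ → nil) nil′ size (λ _ → ⇓nil) bounded-size

infixr 4 _⨾ᶠ_

_⨾ᶠ_ : FP → FP → FP
p ⨾ᶠ q = mkFP (λ x → fun q (fun p x)) (prog p ⨾ prog q)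
  (λ x → time p x + time q (fun p x))
  (λ x → ⇓seq (run p x) (run q (fun p x)))
  (bounded-+ (time-bounded p) (bounded-∘ (fun p) (fun-bounded p) (time-bounded q)))

infixr 5 _∙ᶠ_

_∙ᶠ_ : FP → FP → FP
p ∙ᶠ q = mkFP (λ x → fun p x ∙ fun q x) ⟨ prog p , prog q ⟩
  (λ x → size x + (time p x + time q x))
  (λ x → ⇓pair (run p x) (run q x))
  (bounded-+ bounded-size (bounded-+ (time-bounded p) (time-bounded q)))

ifᶠ : FP → FP → FP → FP
ifᶠ b p q = mkFP (λ x → ifᵗ (fun b x) (fun p x) (fun q x)) (if prog b then prog p else prog q)
  cost ok
  (bounded-mono
    (bounded-+ bounded-size (bounded-+ (time-bounded b) (bounded-+ (time-bounded p) (time-bounded q))))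
    cost≤)
  where
    branch : Tree → Tree → ℕ
    branch x nil     = time q x
    branch x (_ ∙ _) = time p x
    cost : Tree → ℕ
    cost x = size x + (time b x + branch x (fun b x))
    ok : ∀ x → if prog b then prog p else prog q ⊢ x ⇓ ifᵗ (fun b x) (fun p x) (fun q x) [ cost x ]
    ok x with fun b x | run b x
    ... | nil   | r = ⇓else r (run q x)
    ... | _ ∙ _ | r = ⇓then r (run p x)
    branch≤ : ∀ x y → branch x y ≤ time p x + time q x
    branch≤ x nil     = m≤n+m _ _
    branch≤ x (_ ∙ _) = m≤m+n _ _
    cost≤ : ∀ x → cost x ≤ size x + (time b x + (time p x + time q x))
    cost≤ x = +-monoʳ-≤ (size x) (+-monoʳ-≤ (time b x) (branch≤ x (fun b x)))

len : Tree → ℕ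
len nil      = 0
len (_ ∙ xs) = suc (len xs)

len<size : ∀ xs → len xs < size xs
len<size nil      = ≤-refl
len<size (x ∙ xs) = s≤s (≤-trans (len<size xs) (m≤n+m _ _))

-- Trees are lists of their left subtrees.  The loop visits the nonempty
-- suffixes of a list xs, with a fixed parameter e and an accumulator r.
loop : (Tree → Tree) → Tree → Tree → Tree → Tree
loop f nil      e r = r
loop f (x ∙ xs) e r = loop f xs e (f ((x ∙ xs) ∙ e ∙ r))

-- A step may enlarge the accumulator only by an amount that is polynomial in the data it does not
-- change. If that amount could depend on the accumulator, iteration might double it each time and
-- grow exponentially.
module _ (f : FP) (c d : ℕ)
         (growth : ∀ x xs e r → size (fun f ((x ∙ xs) ∙ e ∙ r)) ≤ size r + c * size ((x ∙ xs) ∙ e) ^ d)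
  where

  private
    body : FP
    body = (hdᶠ ⨾ᶠ tlᶠ) ∙ᶠ (tlᶠ ⨾ᶠ hdᶠ) ∙ᶠ f

    cb = proj₁ (time-bounded body)
    db = proj₁ (proj₂ (time-bounded body))

    -- V bounds the size of every state of the loop.
    iterations : ∀ V W xs e r → size (xs ∙ e) ≤ W →
                 size (xs ∙ e ∙ r) + len xs * (c * W ^ d) ≤ V →
                 ∃[ t ] ( while hd run prog body ⊢ xs ∙ e ∙ r ⇓ nil ∙ e ∙ loop (fun f) xs e r [ t ]
                        × t ≤ suc (len xs) * (2 * V + cb * V ^ db) )
    iterations V W nil e r le≤W le≤V = _ , ⇓stop ⇓hd , (begin
        S + S                         ≤⟨ +-mono-≤ S≤V S≤V ⟩
        V + V                         ≡⟨ dbl V ⟩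
        2 * V                         ≤⟨ m≤m+n _ _ ⟩
        2 * V + cb * V ^ db           ≡⟨ *-identityˡ _ ⟨
        1 * (2 * V + cb * V ^ db)     ∎)
      where
        open ≤-Reasoning
        S = size (nil ∙ e ∙ r)
        S≤V : S ≤ V
        S≤V = ≤-trans (m≤m+n _ _) le≤V
        dbl : ∀ v → v + v ≡ 2 * v
        dbl = solve-∀
    iterations V W (x ∙ xs) e r le≤W le≤V = _ , ⇓loop ⇓hd (run body z) (proj₁ (proj₂ rest)) , (begin
        S + (S + time body z + proj₁ rest)
          ≤⟨ +-mono-≤ S≤V (+-mono-≤ (+-mono-≤ S≤V (≤-trans (proj₂ (proj₂ (time-bounded body)) z)
               (*-monoʳ-≤ cb (^-monoˡ-≤ db S≤V)))) (proj₂ (proj₂ rest))) ⟩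
        V + (V + cb * V ^ db + suc (len xs) * (2 * V + cb * V ^ db))
          ≡⟨ arrange V (cb * V ^ db) _ ⟩
        suc (suc (len xs)) * (2 * V + cb * V ^ db)                    ∎)
      where
        open ≤-Reasoning
        z = (x ∙ xs) ∙ e ∙ r
        S = size z
        r′ = fun f z
        g = c * W ^ d
        S≤V : S ≤ V
        S≤V = ≤-trans (m≤m+n _ _) le≤V
        arrange : ∀ v b l → v + (v + b + l) ≡ 2 * v + b + l
        arrange = solve-∀
        suffix≤ : size (xs ∙ e) ≤ size ((x ∙ xs) ∙ e)
        suffix≤ = s≤s (+-monoˡ-≤ (size e) (right≤ (x ∙ xs)))
        r′≤ : size r′ ≤ size r + g
        r′≤ = ≤-trans (growth x xs e r) (+-monoʳ-≤ (size r) (*-monoʳ-≤ c (^-monoˡ-≤ d le≤W)))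
        shuffle : ∀ a b r g l → suc (a + suc (b + (r + g))) + l * g ≡ suc (a + suc (b + r)) + (g + l * g)
        shuffle = solve-∀
        -- A potential argument: the size of the state plus the growth still allowed to the
        -- remaining iterations never increases.
        next≤V : size (xs ∙ e ∙ r′) + len xs * g ≤ V
        next≤V = begin
          size (xs ∙ e ∙ r′) + len xs * g
            ≤⟨ +-monoˡ-≤ _ (s≤s (+-mono-≤ (right≤ (x ∙ xs)) (s≤s (+-monoʳ-≤ (size e) r′≤)))) ⟩
          suc (size (x ∙ xs) + suc (size e + (size r + g))) + len xs * g
            ≡⟨ shuffle (size (x ∙ xs)) (size e) (size r) g (len xs) ⟩
          S + suc (len xs) * g  ≤⟨ le≤V ⟩
          V                     ∎
        rest = iterations V W xs e r′ (≤-trans suffix≤ le≤W) next≤V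

    initial : FP
    initial = hdᶠ ∙ᶠ (tlᶠ ⨾ᶠ hdᶠ) ∙ᶠ (tlᶠ ⨾ᶠ tlᶠ)

    final : FP
    final = tlᶠ ⨾ᶠ tlᶠ

    S V T : Tree → ℕ
    S z = size (fun initial z)
    V z = S z + S z * (c * S z ^ d)
    T z = S z * (2 * V z + cb * V z ^ db)

    V-bounded : PolyBounded V
    V-bounded = bounded-+ S-bounded
      (bounded-* S-bounded (bounded-* (bounded-const c) (bounded-^ d S-bounded)))
      where S-bounded = fun-bounded initial

    T-bounded : PolyBounded T
    T-bounded = bounded-* (fun-bounded initial)
      (bounded-+ (bounded-* (bounded-const 2) V-bounded)
                 (bounded-* (bounded-const cb) (bounded-^ db V-bounded)))

    module _ (z : Tree) where
      xs₀ = left z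
      e₀  = left (right z)
      r₀  = right (right z)

      len<S : len xs₀ < S z
      len<S = ≤-trans (len<size xs₀) (m≤n⇒m≤1+n (m≤m+n _ _))

      iterated = iterations (V z) (S z) xs₀ e₀ r₀
        (s≤s (+-monoʳ-≤ (size xs₀) (m≤n⇒m≤1+n (m≤m+n _ _))))
        (+-monoʳ-≤ (S z) (*-monoˡ-≤ (c * S z ^ d) (<⇒≤ len<S)))

      end : Tree
      end = nil ∙ e₀ ∙ loop (fun f) xs₀ e₀ r₀

      iterated≤T : proj₁ iterated ≤ T z
      iterated≤T = ≤-trans (proj₂ (proj₂ iterated)) (*-monoˡ-≤ _ len<S)

      final≤ : time final end ≤ proj₁ (time-bounded final) * T z ^ proj₁ (proj₂ (time-bounded final))
      final≤ = ≤-trans (proj₂ (proj₂ (time-bounded final)) end)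
        (*-monoʳ-≤ (proj₁ (time-bounded final))
          (^-monoˡ-≤ (proj₁ (proj₂ (time-bounded final)))
            (≤-trans (output≤cost (proj₁ (proj₂ iterated))) iterated≤T)))

  loopᶠ : FP
  loopᶠ = mkFP (λ z → loop (fun f) (left z) (left (right z)) (right (right z)))
    (prog initial ⨾ while hd run prog body ⨾ prog final)
    (λ z → time initial z + (proj₁ (iterated z) + time final (end z)))
    (λ z → ⇓seq (run initial z) (⇓seq (proj₁ (proj₂ (iterated z))) (run final (end z))))
    (bounded-mono
      (bounded-+ (time-bounded initial)
        (bounded-+ T-bounded
          (bounded-* (bounded-const (proj₁ (time-bounded final)))
                     (bounded-^ (proj₁ (proj₂ (time-bounded final))) T-bounded))))
      (λ z → +-monoʳ-≤ (time initial z) (+-mono-≤ (iterated≤T z) (final≤ z))))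

-- The values of f at the pairs (e , suffix), for the nonempty suffixes of xs
-- starting with the shortest one, in front of r.
scan : (Tree → Tree) → Tree → Tree → Tree → Tree
scan f e nil      r = r
scan f e (x ∙ xs) r = scan f e xs (f (e ∙ x ∙ xs) ∙ r)

foldᵗ : (Tree → Tree) → Tree → Tree → Tree
foldᵗ f nil      r = r
foldᵗ f (x ∙ xs) r = foldᵗ f xs (f (x ∙ r))

scanᶠ : FP → FP
scanᶠ f = mkFP (λ z → scan (fun f) (left z) (right z) nil)
    (prog p) (time p) (λ z → subst (prog p ⊢ z ⇓_[ time p z ]) (loop≡scan (right z) (left z) nil) (run p z))
    (time-bounded p)
  where
  step : FP
  step = (((tlᶠ ⨾ᶠ hdᶠ) ∙ᶠ hdᶠ) ⨾ᶠ f) ∙ᶠ (tlᶠ ⨾ᶠ tlᶠ)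
  c = proj₁ (fun-bounded f)
  d = proj₁ (proj₂ (fun-bounded f))
  -- The value of `f` accounts for `c`; the new list cell costs 1, which the extra copy of the power
  -- absorbs.
  growth : ∀ x xs e r → size (fun step ((x ∙ xs) ∙ e ∙ r)) ≤ size r + suc c * size ((x ∙ xs) ∙ e) ^ d
  growth x xs e r = begin
    suc (size (fun f (e ∙ x ∙ xs)) + size r)
      ≤⟨ s≤s (+-monoˡ-≤ (size r) (proj₂ (proj₂ (fun-bounded f)) (e ∙ x ∙ xs))) ⟩
    suc (c * size (e ∙ x ∙ xs) ^ d + size r)
      ≡⟨ cong (λ s → suc (c * suc s ^ d + size r)) (+-comm (size e) (size (x ∙ xs))) ⟩
    1 + (c * K + size r)
      ≤⟨ +-monoˡ-≤ (c * K + size r) (m^n>0 (size ((x ∙ xs) ∙ e)) d) ⟩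
    K + (c * K + size r)      ≡⟨ arrange K (c * K) (size r) ⟩
    size r + (K + c * K)      ∎
    where
      open ≤-Reasoning
      K = size ((x ∙ xs) ∙ e) ^ d
      arrange : ∀ a b r → a + (b + r) ≡ r + (a + b)
      arrange = solve-∀
  p : FP
  p = (tlᶠ ∙ᶠ hdᶠ ∙ᶠ nilᶠ) ⨾ᶠ loopᶠ step (suc c) d growth
  loop≡scan : ∀ xs e r → loop (fun step) xs e r ≡ scan (fun f) e xs r
  loop≡scan nil      e r = refl
  loop≡scan (x ∙ xs) e r = loop≡scan xs e _

-- The growth condition of `loopᶠ` with exponent 1: a step may add a constant and the entry that it
-- consumes. This covers both moving entries into the accumulator and updating a state of nearly
-- constant size.
foldᶠ : (f : FP) (k : ℕ) → (∀ x r → size (fun f (x ∙ r)) ≤ size r + k + size x) → FP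
foldᶠ f k growth = mkFP (λ z → foldᵗ (fun f) (left z) (right z))
    (prog p) (time p) (λ z → subst (prog p ⊢ z ⇓_[ time p z ]) (loop≡fold (left z) nil (right z)) (run p z))
    (time-bounded p)
  where
  step : FP
  step = ((hdᶠ ⨾ᶠ hdᶠ) ∙ᶠ (tlᶠ ⨾ᶠ tlᶠ)) ⨾ᶠ f
  growth′ : ∀ x xs e r → size (fun step ((x ∙ xs) ∙ e ∙ r)) ≤ size r + suc k * size ((x ∙ xs) ∙ e) ^ 1
  growth′ x xs e r = begin
    size (fun f (x ∙ r))            ≤⟨ growth x r ⟩
    size r + k + size x             ≡⟨ +-assoc (size r) k (size x) ⟩
    size r + (k + size x)           ≤⟨ +-monoʳ-≤ (size r) (+-mono-≤ k≤ x≤) ⟩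
    size r + (k * L + L)            ≡⟨ cong (size r +_) (+-comm (k * L) L) ⟩
    size r + (L + k * L)            ≡⟨ cong (λ l → size r + (l + k * l)) (*-identityʳ L) ⟨
    size r + (L ^ 1 + k * L ^ 1)    ∎
    where
      open ≤-Reasoning
      L = size ((x ∙ xs) ∙ e)
      k≤ : k ≤ k * L
      k≤ = m≤m*n k L
      x≤ : size x ≤ L
      x≤ = ≤-trans (left≤ (x ∙ xs)) (left≤ ((x ∙ xs) ∙ e))
  p : FP
  p = (hdᶠ ∙ᶠ nilᶠ ∙ᶠ tlᶠ) ⨾ᶠ loopᶠ step (suc k) 1 growth′
  loop≡fold : ∀ xs e r → loop (fun step) xs e r ≡ foldᵗ (fun f) xs r
  loop≡fold nil      e r = refl
  loop≡fold (x ∙ xs) e r = loop≡fold xs e _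

-- Lists of trees

infixr 5 _++ᵗ_

_++ᵗ_ : Tree → Tree → Tree
nil      ++ᵗ t = t
(x ∙ xs) ++ᵗ t = x ∙ (xs ++ᵗ t)

concatᵗ : Tree → Tree
concatᵗ nil      = nil
concatᵗ (x ∙ xs) = x ++ᵗ concatᵗ xs

++ᵗ-assoc : ∀ s t u → (s ++ᵗ t) ++ᵗ u ≡ s ++ᵗ (t ++ᵗ u)
++ᵗ-assoc nil      t u = refl
++ᵗ-assoc (x ∙ xs) t u = cong (x ∙_) (++ᵗ-assoc xs t u)

++ᵗ-identityʳ : ∀ s → s ++ᵗ nil ≡ s
++ᵗ-identityʳ nil      = refl
++ᵗ-identityʳ (x ∙ xs) = cong (x ∙_) (++ᵗ-identityʳ xs)

revOnto : Tree → Tree → Tree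
revOnto = foldᵗ (λ z → z)

revOnto-size : ∀ s t → size (revOnto s t) ≤ size t + size s
revOnto-size nil      t = m≤m+n _ _
revOnto-size (x ∙ xs) t = ≤-trans (revOnto-size xs (x ∙ t)) (≤-reflexive (arrange (size x) (size xs) (size t)))
  where
  arrange : ∀ a b c → suc (a + c) + b ≡ c + suc (a + b)
  arrange = solve-∀

revOnto-++ : ∀ s t u → revOnto (revOnto s t) u ≡ revOnto t (s ++ᵗ u)
revOnto-++ nil      t u = refl
revOnto-++ (x ∙ xs) t u = revOnto-++ xs (x ∙ t) u

revOnto-acc : ∀ s t → revOnto s t ≡ revOnto s nil ++ᵗ t
revOnto-acc nil      t = refl
revOnto-acc (x ∙ xs) t =
  trans (revOnto-acc xs (x ∙ t))
    (sym (trans (cong (_++ᵗ t) (revOnto-acc xs (x ∙ nil))) (++ᵗ-assoc (revOnto xs nil) (x ∙ nil) t)))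

revOntoᶠ : FP
revOntoᶠ = foldᶠ idᶠ 1 (λ x r → ≤-reflexive (arrange (size x) (size r)))
  where
  arrange : ∀ a b → suc (a + b) ≡ b + 1 + a
  arrange = solve-∀

revᶠ : FP
revᶠ = (idᶠ ∙ᶠ nilᶠ) ⨾ᶠ revOntoᶠ

infixr 5 _++ᶠ_

_++ᶠ_ : FP → FP → FP
p ++ᶠ q = ((p ⨾ᶠ revᶠ) ∙ᶠ q) ⨾ᶠ revOntoᶠ

fun-++ᶠ : ∀ p q z → fun (p ++ᶠ q) z ≡ fun p z ++ᵗ fun q z
fun-++ᶠ p q z = revOnto-++ (fun p z) nil (fun q z)

-- Each piece is pushed in reverse onto the result, which is reversed once at the end. A step then
-- adds only the size of its piece, as `foldᶠ` demands.
concatᶠ : FP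
concatᶠ = (idᶠ ∙ᶠ nilᶠ) ⨾ᶠ foldᶠ revOntoᶠ 0 growth ⨾ᶠ revᶠ
  where
  growth : ∀ x r → size (revOnto x r) ≤ size r + 0 + size x
  growth x r = subst (λ k → size (revOnto x r) ≤ k + size x) (sym (+-identityʳ (size r))) (revOnto-size x r)

fun-concatᶠ : ∀ z → fun concatᶠ z ≡ concatᵗ z
fun-concatᶠ z = go z nil
  where
  go : ∀ z r → revOnto (foldᵗ (λ z → revOnto (left z) (right z)) z r) nil ≡ revOnto r nil ++ᵗ concatᵗ z
  go nil      r = sym (++ᵗ-identityʳ _)
  go (x ∙ xs) r = begin
    revOnto (foldᵗ _ xs (revOnto x r)) nil   ≡⟨ go xs (revOnto x r) ⟩
    revOnto (revOnto x r) nil ++ᵗ concatᵗ xs  ≡⟨ cong (_++ᵗ concatᵗ xs) (revOnto-++ x r nil) ⟩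
    revOnto r (x ++ᵗ nil) ++ᵗ concatᵗ xs      ≡⟨ cong (λ y → revOnto r y ++ᵗ concatᵗ xs) (++ᵗ-identityʳ x) ⟩
    revOnto r x ++ᵗ concatᵗ xs                ≡⟨ cong (_++ᵗ concatᵗ xs) (revOnto-acc r x) ⟩
    (revOnto r nil ++ᵗ x) ++ᵗ concatᵗ xs      ≡⟨ ++ᵗ-assoc (revOnto r nil) x (concatᵗ xs) ⟩
    revOnto r nil ++ᵗ (x ++ᵗ concatᵗ xs)      ∎
    where open ≡-Reasoning

-- Repetition, unary numbers and indexing

repeatᵗ : ℕ → Tree → Tree
repeatᵗ zero    t = nil
repeatᵗ (suc n) t = t ∙ repeatᵗ n t

repeat-snoc : ∀ n t r → repeatᵗ n t ++ᵗ (t ∙ r) ≡ t ∙ (repeatᵗ n t ++ᵗ r)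
repeat-snoc zero    t r = refl
repeat-snoc (suc n) t r = cong (t ∙_) (repeat-snoc n t r)

repeatᶠ : FP → FP → FP
repeatᶠ n p = (p ∙ᶠ n) ⨾ᶠ scanᶠ hdᶠ

fun-repeatᶠ : ∀ n p z → fun (repeatᶠ n p) z ≡ repeatᵗ (len (fun n z)) (fun p z)
fun-repeatᶠ n p z = trans (go (fun n z) nil) (++ᵗ-identityʳ _)
  where
  go : ∀ xs r → scan left (fun p z) xs r ≡ repeatᵗ (len xs) (fun p z) ++ᵗ r
  go nil      r = refl
  go (x ∙ xs) r = trans (go xs _) (repeat-snoc (len xs) (fun p z) r)

repeat-nil : ∀ n → repeatᵗ n nil ≡ encℕ n
repeat-nil zero    = refl
repeat-nil (suc n) = cong (nil ∙_) (repeat-nil n)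

len-encℕ : ∀ n → len (encℕ n) ≡ n
len-encℕ zero    = refl
len-encℕ (suc n) = cong suc (len-encℕ n)

lenᶠ : FP → FP
lenᶠ p = repeatᶠ p nilᶠ

fun-lenᶠ : ∀ p z → fun (lenᶠ p) z ≡ encℕ (len (fun p z))
fun-lenᶠ p z = trans (fun-repeatᶠ p nilᶠ z) (repeat-nil _)

encℕ-+ : ∀ m n → encℕ m ++ᵗ encℕ n ≡ encℕ (m + n)
encℕ-+ zero    n = refl
encℕ-+ (suc m) n = cong (nil ∙_) (encℕ-+ m n)

nthᵗ : Tree → ℕ → Tree
nthᵗ xs zero    = left xs
nthᵗ xs (suc k) = nthᵗ (right xs) k

nthᶠ : FP → FP → FP
nthᶠ p k = (k ∙ᶠ p) ⨾ᶠ foldᶠ (tlᶠ ⨾ᶠ tlᶠ) 0 growth ⨾ᶠ hdᶠ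
  where
  growth : ∀ x r → size (right r) ≤ size r + 0 + size x
  growth x r = ≤-trans (right≤ r) (≤-trans (m≤m+n _ 0) (m≤m+n _ (size x)))

fun-nthᶠ : ∀ p k z → fun (nthᶠ p k) z ≡ nthᵗ (fun p z) (len (fun k z))
fun-nthᶠ p k z = go (fun k z) (fun p z)
  where
  go : ∀ ks xs → left (foldᵗ (λ z → right (right z)) ks xs) ≡ nthᵗ xs (len ks)
  go nil      xs = refl
  go (_ ∙ ks) xs = go ks (right xs)

nth-encVec : ∀ {A : Set} {n} (enc : A → Tree) (v : Vec A n) (i : Fin n) →
             nthᵗ (encVec enc v) (toℕ i) ≡ enc (lookup v i)
nth-encVec enc (x ∷ v) zero    = refl
nth-encVec enc (x ∷ v) (suc i) = nth-encVec enc v i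

oneᶠ : FP
oneᶠ = nilᶠ ∙ᶠ nilᶠ

-- Comparing bit strings

truth : Tree → Bool
truth nil     = false
truth (_ ∙ _) = true

truth-encBool : ∀ b → truth (encBool b) ≡ b
truth-encBool false = refl
truth-encBool true  = refl

nth-nil : ∀ k → nthᵗ nil k ≡ nil
nth-nil zero    = refl
nth-nil (suc k) = nth-nil k

-- The state is the unread part of `ys` paired with a flag. A mismatch sets the flag to `nil ∙ nil`,
-- a match keeps it.
diffStep : Tree → Tree
diffStep z = right (left (right z)) ∙
  ifᵗ (left z) (ifᵗ (left (left (right z))) (right (right z)) (nil ∙ nil))
               (ifᵗ (left (left (right z))) (nil ∙ nil) (right (right z)))

-- nil if the lists of Booleans xs and ys agree on the length of xs, where
-- missing entries of ys count as false.
diffᵗ : Tree → Tree → Tree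
diffᵗ xs ys = right (foldᵗ diffStep xs (ys ∙ nil))

diffᶠ : FP → FP → FP
diffᶠ p q = (p ∙ᶠ q ∙ᶠ nilᶠ) ⨾ᶠ foldᶠ step 4 growth ⨾ᶠ tlᶠ
  where
  x y flag step : FP
  x    = hdᶠ
  y    = tlᶠ ⨾ᶠ hdᶠ ⨾ᶠ hdᶠ
  flag = tlᶠ ⨾ᶠ tlᶠ
  step = (tlᶠ ⨾ᶠ hdᶠ ⨾ᶠ tlᶠ) ∙ᶠ ifᶠ x (ifᶠ y flag oneᶠ) (ifᶠ y oneᶠ flag)
  if-size : ∀ b s t k → size s ≤ k → size t ≤ k → size (ifᵗ b s t) ≤ k
  if-size nil     s t k s≤ t≤ = t≤
  if-size (_ ∙ _) s t k s≤ t≤ = s≤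
  arrange : ∀ a b → suc (a + (3 + b)) ≡ suc (a + b) + 3
  arrange = solve-∀
  -- The growth bound must hold on malformed states too; the constant 4 comes from `r = nil`, where
  -- both sides are 6.
  children : ∀ r → suc (size (left r) + (3 + size (right r))) ≤ size r + 4 + 1
  children nil     = ≤-refl
  children (s ∙ t) = ≤-trans (≤-reflexive (arrange (size s) (size t)))
    (≤-trans (+-monoʳ-≤ (size (s ∙ t)) (n≤1+n 3)) (m≤m+n _ 1))
  growth : ∀ x r → size (diffStep (x ∙ r)) ≤ size r + 4 + size x
  growth x r = begin
    suc (size (right (left r)) + size (ifᵗ x (ifᵗ y₀ f one) (ifᵗ y₀ one f)))
      ≤⟨ s≤s (+-mono-≤ (right≤ (left r))
           (if-size x _ _ (3 + size f) (if-size y₀ f one _ f≤ one≤) (if-size y₀ one f _ one≤ f≤))) ⟩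
    suc (size (left r) + (3 + size f))   ≤⟨ children r ⟩
    size r + 4 + 1                       ≤⟨ +-monoʳ-≤ (size r + 4) (size>0 x) ⟩
    size r + 4 + size x                  ∎
    where
      open ≤-Reasoning
      y₀ = left (left r)
      f = right r
      one = nil ∙ nil
      f≤ : size f ≤ 3 + size f
      f≤ = m≤n+m _ 3
      one≤ : 3 ≤ 3 + size f
      one≤ = m≤m+n 3 _

-- The flag is never cleared, so a single mismatch is still visible at the end.
diff-flagged : ∀ xs ys s t → right (foldᵗ diffStep xs (ys ∙ s ∙ t)) ≢ nil
diff-flagged nil            ys s t ()
diff-flagged (nil ∙ xs)     ys s t with left ys
... | nil   = diff-flagged xs (right ys) s t
... | _ ∙ _ = diff-flagged xs (right ys) nil nil
diff-flagged ((_ ∙ _) ∙ xs) ys s t with left ys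
... | nil   = diff-flagged xs (right ys) nil nil
... | _ ∙ _ = diff-flagged xs (right ys) s t

diff-sound : ∀ {n} (x : U n) ys → diffᵗ (encU x) ys ≡ nil → ∀ i → lookup x i ≡ truth (nthᵗ ys (toℕ i))
diff-sound (b ∷ x) ys eq with b | left ys in h
... | false | nil   = λ { zero → sym (cong truth h) ; (suc i) → diff-sound x (right ys) eq i }
... | false | _ ∙ _ = ⊥-elim (diff-flagged (encU x) (right ys) nil nil eq)
... | true  | nil   = ⊥-elim (diff-flagged (encU x) (right ys) nil nil eq)
... | true  | _ ∙ _ = λ { zero → sym (cong truth h) ; (suc i) → diff-sound x (right ys) eq i }

diff-complete : ∀ {n} (x : U n) ys → (∀ i → lookup x i ≡ truth (nthᵗ ys (toℕ i))) → diffᵗ (encU x) ys ≡ nil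
diff-complete []      ys eq = refl
diff-complete (b ∷ x) ys eq with b | left ys | eq zero
... | false | nil   | _ = diff-complete x (right ys) (λ i → eq (suc i))
... | true  | _ ∙ _ | _ = diff-complete x (right ys) (λ i → eq (suc i))

++ᵗ-nil⁻ : ∀ xs ys → xs ++ᵗ ys ≡ nil → xs ≡ nil × ys ≡ nil
++ᵗ-nil⁻ nil ys eq = refl , eq

vec-ext : ∀ {n} {x y : U n} → (∀ i → lookup x i ≡ lookup y i) → x ≡ y
vec-ext {x = []}    {[]}    eq = refl
vec-ext {x = _ ∷ _} {_ ∷ _} eq = cong₂ _∷_ (eq zero) (vec-ext (λ i → eq (suc i)))

truth-nth-encU : ∀ {n} (y : U n) i → truth (nthᵗ (encU y) (toℕ i)) ≡ lookup y i
truth-nth-encU y i = trans (cong truth (nth-encVec encBool y i)) (truth-encBool (lookup y i))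

-- Evaluating gates and circuits

nthᶠ-lookup : ∀ {n} p k z {v : U n} (i : Fin n) → fun p z ≡ encU v → fun k z ≡ encFin i →
              fun (nthᶠ p k) z ≡ encBool (lookup v i)
nthᶠ-lookup p k z {v} i eq eq′ = begin
  fun (nthᶠ p k) z                       ≡⟨ fun-nthᶠ p k z ⟩
  nthᵗ (fun p z) (len (fun k z))         ≡⟨ cong₂ (λ xs ks → nthᵗ xs (len ks)) eq eq′ ⟩
  nthᵗ (encU v) (len (encFin i))         ≡⟨ cong (nthᵗ (encU v)) (len-encℕ (toℕ i)) ⟩
  nthᵗ (encU v) (toℕ i)                  ≡⟨ nth-encVec encBool v i ⟩
  encBool (lookup v i)                   ∎
  where open ≡-Reasoning

-- The tag of a gate is a unary number from 0 to 3; the nested tests peel it off one `nil` at a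
-- time.
gateᶠ : FP
gateᶠ = ifᶠ tag (ifᶠ (tag ⨾ᶠ tlᶠ) (ifᶠ (tag ⨾ᶠ tlᶠ ⨾ᶠ tlᶠ)
    (ifᶠ wire₁ oneᶠ wire₂)
    (ifᶠ wire₁ wire₂ nilᶠ))
    (ifᶠ (wire args) nilᶠ oneᶠ))
    args
  where
  tag  = hdᶠ ⨾ᶠ hdᶠ
  args = hdᶠ ⨾ᶠ tlᶠ
  wire : FP → FP
  wire = nthᶠ tlᶠ
  wire₁ = wire (args ⨾ᶠ hdᶠ)
  wire₂ = wire (args ⨾ᶠ tlᶠ)

if-neg : ∀ b → ifᵗ (encBool b) nil (nil ∙ nil) ≡ encBool (not b)
if-neg false = refl
if-neg true  = refl

if-and : ∀ b c → ifᵗ (encBool b) (encBool c) nil ≡ encBool (b ∧ c)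
if-and false c = refl
if-and true  c = refl

if-or : ∀ b c → ifᵗ (encBool b) (nil ∙ nil) (encBool c) ≡ encBool (b ∨ c)
if-or false c = refl
if-or true  c = refl

fun-gateᶠ : ∀ {w} (g : Gate w) (v : Vec Bool w) → fun gateᶠ (encGate g ∙ encU v) ≡ encBool (evalGate g v)
fun-gateᶠ (const b) v = refl
fun-gateᶠ (neg i)   v =
  trans (cong (λ s → ifᵗ s nil (nil ∙ nil)) (nthᶠ-lookup tlᶠ (hdᶠ ⨾ᶠ tlᶠ) (encGate (neg i) ∙ encU v) {v} i refl refl))
        (if-neg (lookup v i))
fun-gateᶠ (and i j) v =
  trans (cong₂ (λ s t → ifᵗ s t nil)
               (nthᶠ-lookup tlᶠ ((hdᶠ ⨾ᶠ tlᶠ) ⨾ᶠ hdᶠ) (encGate (and i j) ∙ encU v) {v} i refl refl)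
               (nthᶠ-lookup tlᶠ ((hdᶠ ⨾ᶠ tlᶠ) ⨾ᶠ tlᶠ) (encGate (and i j) ∙ encU v) {v} j refl refl))
        (if-and (lookup v i) (lookup v j))
fun-gateᶠ (or i j)  v =
  trans (cong₂ (λ s t → ifᵗ s (nil ∙ nil) t)
               (nthᶠ-lookup tlᶠ ((hdᶠ ⨾ᶠ tlᶠ) ⨾ᶠ hdᶠ) (encGate (or i j) ∙ encU v) {v} i refl refl)
               (nthᶠ-lookup tlᶠ ((hdᶠ ⨾ᶠ tlᶠ) ⨾ᶠ tlᶠ) (encGate (or i j) ∙ encU v) {v} j refl refl))
        (if-or (lookup v i) (lookup v j))

-- The value of a gate is renormalised to nil or nil ∙ nil, so that a step
-- adds at most a constant to the size also on trees that encode no gate.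
evalGatesᶠ : FP
evalGatesᶠ = foldᶠ (ifᶠ gateᶠ oneᶠ nilᶠ ∙ᶠ tlᶠ) 4 growth
  where
  normalised : ∀ t → size (ifᵗ t (nil ∙ nil) nil) ≤ 3
  normalised nil     = s≤s z≤n
  normalised (_ ∙ _) = ≤-refl
  growth : ∀ x r → suc (size (ifᵗ (fun gateᶠ (x ∙ r)) (nil ∙ nil) nil) + size r) ≤ size r + 4 + size x
  growth x r = ≤-trans (s≤s (+-monoˡ-≤ (size r) (normalised (fun gateᶠ (x ∙ r)))))
    (≤-trans (≤-reflexive (+-comm 4 (size r))) (m≤m+n _ (size x)))

if-bool : ∀ b → ifᵗ (encBool b) (nil ∙ nil) nil ≡ encBool b
if-bool false = refl
if-bool true  = refl

fun-evalGatesᶠ : ∀ {w w′} (gs : Gates w w′) (v : Vec Bool w) →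
                 fun evalGatesᶠ (encGates gs ∙ encU v) ≡ encU (evalGates gs v)
fun-evalGatesᶠ []       v = refl
fun-evalGatesᶠ (g ∷ gs) v =
  trans (cong (λ b → fun evalGatesᶠ (encGates gs ∙ b ∙ encU v))
          (trans (cong (λ b → ifᵗ b (nil ∙ nil) nil) (fun-gateᶠ g v)) (if-bool (evalGate g v))))
        (fun-evalGatesᶠ gs (evalGate g v ∷ v))

evalᶠ : FP → FP → FP
evalᶠ c a = (((((c ⨾ᶠ hdᶠ) ∙ᶠ a) ⨾ᶠ evalGatesᶠ) ∙ᶠ (c ⨾ᶠ tlᶠ)) ⨾ᶠ scanᶠ output) ⨾ᶠ revᶠ
  where
  output : FP
  output = nthᶠ hdᶠ (tlᶠ ⨾ᶠ hdᶠ)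

fun-evalᶠ : ∀ c a z {m o} (C : Circuit m o) (x : U m) → fun c z ≡ encCircuit C → fun a z ≡ encU x →
            fun (evalᶠ c a) z ≡ encU (eval C x)
fun-evalᶠ c a z C x eq eq′ = begin
  fun (evalᶠ c a) z
    ≡⟨ cong₂ (λ s t → revOnto (scan output (fun evalGatesᶠ (left s ∙ t)) (right s) nil) nil) eq eq′ ⟩
  revOnto (scan output (fun evalGatesᶠ (encGates (gates C) ∙ encU x)) (encVec encFin (outputs C)) nil) nil
    ≡⟨ cong (λ t → revOnto (scan output t (encVec encFin (outputs C)) nil) nil) (fun-evalGatesᶠ (gates C) x) ⟩
  revOnto (scan output (encU wires) (encVec encFin (outputs C)) nil) nil
    ≡⟨ go (outputs C) nil ⟩
  encU (eval C x) ∎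
  where
  open ≡-Reasoning
  wires = evalGates (gates C) x
  output = fun (nthᶠ hdᶠ (tlᶠ ⨾ᶠ hdᶠ))
  go : ∀ {o} (is : Vec (Fin _) o) r →
       revOnto (scan output (encU wires) (encVec encFin is) r) nil ≡ revOnto r (encU (map (lookup wires) is))
  go []       r = refl
  go (i ∷ is) r = trans (go is _)
    (cong (λ b → revOnto r (b ∙ encU (map (lookup wires) is)))
      (nthᶠ-lookup hdᶠ (tlᶠ ⨾ᶠ hdᶠ) (encU wires ∙ encFin i ∙ encVec encFin is) {wires} i refl refl))

-- Extracting a solution of Collision

Allᵗ : (Tree → Set) → Tree → Set
Allᵗ P nil      = ⊤
Allᵗ P (x ∙ xs) = P x × Allᵗ P xs

module _ {P : Tree → Set} where

  all-++ : ∀ s t → Allᵗ P s → Allᵗ P t → Allᵗ P (s ++ᵗ t)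
  all-++ nil      t _          pt = pt
  all-++ (x ∙ xs) t (px , pxs) pt = px , all-++ xs t pxs pt

  all-concat : ∀ t → Allᵗ (Allᵗ P) t → Allᵗ P (concatᵗ t)
  all-concat nil      _          = tt
  all-concat (x ∙ xs) (px , pxs) = all-++ x (concatᵗ xs) px (all-concat xs pxs)

  all-if : ∀ b s t → (b ≡ nil → Allᵗ P t) → Allᵗ P s → Allᵗ P (ifᵗ b s t)
  all-if nil     s t pt ps = pt refl
  all-if (_ ∙ _) s t pt ps = ps

concat-empty : ∀ t → concatᵗ t ≡ nil → Allᵗ (_≡ nil) t
concat-empty nil        eq = tt
concat-empty (nil ∙ xs) eq = refl , concat-empty xs eq

-- Shaped after `scan`, which hands each entry over together with the entries behind it. A scan
-- within a scan therefore meets every pair of positions `j < k` once.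
EachSuffix : ∀ {A : Set} {n} → (∀ {m} → A → Vec A m → Set) → Vec A n → Set
EachSuffix R []       = ⊤
EachSuffix R (x ∷ xs) = R x xs × EachSuffix R xs

eachSuffix-map : ∀ {A : Set} {n} {R S : ∀ {m} → A → Vec A m → Set} →
                 (∀ {m} x (xs : Vec A m) → R x xs → S x xs) → (v : Vec A n) → EachSuffix R v → EachSuffix S v
eachSuffix-map imp []       _          = tt
eachSuffix-map imp (x ∷ xs) (rx , rxs) = imp x xs rx , eachSuffix-map imp xs rxs

module _ {A : Set} (enc : A → Tree) (P : Tree → Set) (f : Tree → Tree) (e : Tree) where

  private
    R : ∀ {m} → A → Vec A m → Set
    R x xs = P (f (e ∙ enc x ∙ encVec enc xs))

  scan-all⁺ : ∀ {n} (v : Vec A n) {r} → EachSuffix R v → Allᵗ P r → Allᵗ P (scan f e (encVec enc v) r)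
  scan-all⁺ []       _          pr = pr
  scan-all⁺ (x ∷ xs) (rx , rxs) pr = scan-all⁺ xs rxs (rx , pr)

  scan-all⁻ : ∀ {n} (v : Vec A n) {r} → Allᵗ P (scan f e (encVec enc v) r) → EachSuffix R v × Allᵗ P r
  scan-all⁻ []       pr = tt , pr
  scan-all⁻ (x ∷ xs) pr with scan-all⁻ xs pr
  ... | rxs , rx , pr′ = (rx , rxs) , pr′

eachIndex : ∀ {A : Set} {n} (R : A → A → Set) (v : Vec A n) →
            EachSuffix (λ x xs → ∀ i → R x (lookup xs i)) v →
            ∀ j k → toℕ j < toℕ k → R (lookup v j) (lookup v k)
eachIndex R (x ∷ xs) (rx , rxs) zero    (suc k) _         = rx k
eachIndex R (x ∷ xs) (rx , rxs) (suc j) (suc k) (s≤s j<k) = eachIndex R xs rxs j k j<k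

eachElement : ∀ {A : Set} {n} {R : A → Set} (v : Vec A n) →
              EachSuffix (λ x xs → R x) v → ∀ j → R (lookup v j)
eachElement (x ∷ xs) (rx , rxs) zero    = rx
eachElement (x ∷ xs) (rx , rxs) (suc j) = eachElement xs rxs j

suffix≢ : ∀ {A Q : Set} {n} (v : Vec A n) → (Q → Injective _≡_ _≡_ (lookup v)) →
          EachSuffix (λ x xs → Q → ∀ i → x ≢ lookup xs i) v
suffix≢ []       inj = tt
suffix≢ (x ∷ xs) inj =
  (λ q i eq → zero≢suc (inj q {zero} {suc i} eq)) ,
  suffix≢ xs (λ q eq → suc-injective (inj q {suc _} {suc _} eq))
  where
  zero≢suc : ∀ {n} {i : Fin n} → zero ≢ Fin.suc i
  zero≢suc ()


collisionᶠ : FP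
collisionᶠ = ifᶠ (diffᶠ (evalᶠ c a) (evalᶠ c b)) nilᶠ ((oneᶠ ∙ᶠ a ∙ᶠ b) ∙ᶠ nilᶠ)
  where
  c = hdᶠ ⨾ᶠ hdᶠ
  a = hdᶠ ⨾ᶠ tlᶠ
  b = tlᶠ ⨾ᶠ hdᶠ

collisionsᶠ : FP
collisionsᶠ = ((hdᶠ ∙ᶠ (tlᶠ ⨾ᶠ hdᶠ)) ∙ᶠ (tlᶠ ⨾ᶠ tlᶠ)) ⨾ᶠ scanᶠ collisionᶠ ⨾ᶠ concatᶠ

-- Missing entries count as false in a comparison, so comparing with `nil` tests for the zero string
-- without building it.
preimageᶠ : FP
preimageᶠ = ifᶠ (diffᶠ (evalᶠ hdᶠ a) nilᶠ) nilᶠ ((nilᶠ ∙ᶠ a) ∙ᶠ nilᶠ)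
  where
  a = tlᶠ ⨾ᶠ hdᶠ

solutionsᶠ : FP
solutionsᶠ = ((hdᶠ ⨾ᶠ tlᶠ) ∙ᶠ tlᶠ) ⨾ᶠ scanᶠ (preimageᶠ ++ᶠ collisionsᶠ) ⨾ᶠ concatᶠ

extractᶠ : FP
extractᶠ = (solutionsᶠ ++ᶠ ((nilᶠ ∙ᶠ (tlᶠ ⨾ᶠ hdᶠ)) ∙ᶠ nilᶠ)) ⨾ᶠ hdᶠ

module _ {n} (C : Circuit n n) (Inj : Set) where

  private
    circ = encCircuit C

  -- The map `g` is defined on all candidates. The output must therefore encode some candidate in
  -- any case, and be a solution only under `Inj`, which the reduction instantiates with the
  -- statement that the given sequence solves Long Choice.
  Sound : Tree → Set
  Sound t = ∃[ s ] (t ≡ encCollisionCandidate s × (Inj → CollisionSolution C s))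

  module _ (a b : U n) (t : Tree) where

    private
      z = (circ ∙ encU a) ∙ encU b ∙ t
      Ca = fun (evalᶠ (hdᶠ ⨾ᶠ hdᶠ) (hdᶠ ⨾ᶠ tlᶠ)) z
      Cb = fun (evalᶠ (hdᶠ ⨾ᶠ hdᶠ) (tlᶠ ⨾ᶠ hdᶠ)) z
      Ca≡ : Ca ≡ encU (eval C a)
      Ca≡ = fun-evalᶠ (hdᶠ ⨾ᶠ hdᶠ) (hdᶠ ⨾ᶠ tlᶠ) z C a refl refl
      Cb≡ : Cb ≡ encU (eval C b)
      Cb≡ = fun-evalᶠ (hdᶠ ⨾ᶠ hdᶠ) (tlᶠ ⨾ᶠ hdᶠ) z C b refl refl

    collisionᶠ-sound : (Inj → a ≢ b) → Allᵗ Sound (fun collisionᶠ z)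
    collisionᶠ-sound a≢b = all-if (diffᵗ Ca Cb) nil ((encBool true ∙ encU a ∙ encU b) ∙ nil) agree tt
      where
      agree : diffᵗ Ca Cb ≡ nil → Allᵗ Sound ((encBool true ∙ encU a ∙ encU b) ∙ nil)
      agree eq = (collision a b , refl , λ inj → a≢b inj , vec-ext (λ i →
        trans (diff-sound (eval C a) (encU (eval C b)) (trans (cong₂ diffᵗ (sym Ca≡) (sym Cb≡)) eq) i)
              (truth-nth-encU (eval C b) i))) , tt

    collisionᶠ-complete : fun collisionᶠ z ≡ nil → eval C a ≢ eval C b
    collisionᶠ-complete eq same with trans (sym (cong (λ d → ifᵗ d nil ((encBool true ∙ encU a ∙ encU b) ∙ nil)) diff≡nil)) eq
      where
      diff≡nil : diffᵗ Ca Cb ≡ nil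
      diff≡nil = trans (cong₂ diffᵗ Ca≡ Cb≡) (diff-complete (eval C a) (encU (eval C b)) (λ i →
        trans (cong (λ y → lookup y i) same) (sym (truth-nth-encU (eval C b) i))))
    ... | ()

  module _ (a : U n) (t : Tree) where

    private
      z = circ ∙ encU a ∙ t
      Ca = fun (evalᶠ hdᶠ (tlᶠ ⨾ᶠ hdᶠ)) z
      Ca≡ : Ca ≡ encU (eval C a)
      Ca≡ = fun-evalᶠ hdᶠ (tlᶠ ⨾ᶠ hdᶠ) z C a refl refl

    preimageᶠ-sound : Allᵗ Sound (fun preimageᶠ z)
    preimageᶠ-sound = all-if (diffᵗ Ca nil) nil ((nil ∙ encU a) ∙ nil) zeros tt
      where
      zeros : diffᵗ Ca nil ≡ nil → Allᵗ Sound ((nil ∙ encU a) ∙ nil)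
      zeros eq = (preimage a , refl , λ _ → vec-ext (λ i →
        trans (diff-sound (eval C a) nil (trans (cong (λ y → diffᵗ y nil) (sym Ca≡)) eq) i)
          (trans (cong truth (nth-nil (toℕ i))) (sym (lookup-replicate i false))))) , tt

    preimageᶠ-complete : fun preimageᶠ z ≡ nil → eval C a ≢ Vec.replicate n false
    preimageᶠ-complete eq same with trans (sym (cong (λ d → ifᵗ d nil ((nil ∙ encU a) ∙ nil)) diff≡nil)) eq
      where
      diff≡nil : diffᵗ Ca nil ≡ nil
      diff≡nil = trans (cong (λ y → diffᵗ y nil) Ca≡) (diff-complete (eval C a) nil (λ i →
        trans (cong (λ y → lookup y i) same)
          (trans (lookup-replicate i false) (sym (cong truth (nth-nil (toℕ i)))))))
    ... | ()

  module _ {m} (a : U n) (as : Vec (U n) m) where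

    private
      z = circ ∙ encU a ∙ encVec encU as
      collisions = scan (fun collisionᶠ) (circ ∙ encU a) (encVec encU as) nil

    solution-sound : (Inj → ∀ i → a ≢ lookup as i) → Allᵗ Sound (fun (preimageᶠ ++ᶠ collisionsᶠ) z)
    solution-sound a≢ = subst (Allᵗ Sound) (sym (fun-++ᶠ preimageᶠ collisionsᶠ z))
      (all-++ (fun preimageᶠ z) _ (preimageᶠ-sound a (encVec encU as))
        (subst (Allᵗ Sound) (sym (fun-concatᶠ collisions))
          (all-concat collisions (scan-all⁺ encU (Allᵗ Sound) (fun collisionᶠ) (circ ∙ encU a) as (each as a≢) tt))))
      where
      each : ∀ {m} (bs : Vec (U n) m) → (Inj → ∀ i → a ≢ lookup bs i) →
             EachSuffix (λ x xs → Allᵗ Sound (fun collisionᶠ ((circ ∙ encU a) ∙ encU x ∙ encVec encU xs))) bs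
      each []       a≢ = tt
      each (b ∷ bs) a≢ = collisionᶠ-sound a b (encVec encU bs) (λ inj → a≢ inj zero) , each bs (λ inj i → a≢ inj (suc i))

    solution-complete : fun (preimageᶠ ++ᶠ collisionsᶠ) z ≡ nil →
                        eval C a ≢ Vec.replicate n false × (∀ i → eval C a ≢ eval C (lookup as i))
    solution-complete eq with ++ᵗ-nil⁻ (fun preimageᶠ z) (fun collisionsᶠ z) (trans (sym (fun-++ᶠ preimageᶠ collisionsᶠ z)) eq)
    ... | eq₁ , eq₂ = preimageᶠ-complete a (encVec encU as) eq₁ ,
      eachElement as (eachSuffix-map (λ b bs → collisionᶠ-complete a b (encVec encU bs)) as
        (proj₁ (scan-all⁻ encU (_≡ nil) (fun collisionᶠ) (circ ∙ encU a) as
          (concat-empty collisions (trans (sym (fun-concatᶠ collisions)) eq₂)))))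

  module _ {m} (N : Tree) (as : Vec (U n) (suc m)) (inj : Inj → Injective _≡_ _≡_ (lookup as)) where

    private
      z = (N ∙ circ) ∙ encVec encU as
      perSuffix = scan (fun (preimageᶠ ++ᶠ collisionsᶠ)) circ (encVec encU as) nil

    Distinct : Set
    Distinct = (∀ j → eval C (lookup as j) ≢ Vec.replicate n false) ×
               (∀ j k → toℕ j < toℕ k → eval C (lookup as j) ≢ eval C (lookup as k))

    solutions-sound : Allᵗ Sound (fun solutionsᶠ z)
    solutions-sound = subst (Allᵗ Sound) (sym (fun-concatᶠ perSuffix))
      (all-concat perSuffix (scan-all⁺ encU (Allᵗ Sound) (fun (preimageᶠ ++ᶠ collisionsᶠ)) circ as
        (eachSuffix-map solution-sound as (suffix≢ as inj)) tt))

    solutions-complete : fun solutionsᶠ z ≡ nil → Distinct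
    solutions-complete eq =
      eachElement as (eachSuffix-map (λ _ _ → proj₁) as each) ,
      eachIndex (λ x y → eval C x ≢ eval C y) as (eachSuffix-map (λ _ _ → proj₂) as each)
      where
      each = eachSuffix-map solution-complete as
        (proj₁ (scan-all⁻ encU (_≡ nil) (fun (preimageᶠ ++ᶠ collisionsᶠ)) circ as
          (concat-empty perSuffix (trans (sym (fun-concatᶠ perSuffix)) eq))))

    extract-spec : (Inj → ¬ Distinct) → Sound (fun extractᶠ z)
    extract-spec ¬distinct = subst (λ t → Sound (left t)) (sym (fun-++ᶠ solutionsᶠ ((nilᶠ ∙ᶠ (tlᶠ ⨾ᶠ hdᶠ)) ∙ᶠ nilᶠ) z))
      (first (fun solutionsᶠ z) solutions-sound solutions-complete as)
      where
      first : ∀ t → Allᵗ Sound t → (t ≡ nil → Distinct) → (as : Vec (U n) (suc m)) →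
              Sound (left (t ++ᵗ ((nil ∙ left (encVec encU as)) ∙ nil)))
      -- The search found nothing, so `Distinct` holds and `Inj` is refuted. The preimage candidate
      -- of the first element only keeps the output well formed.
      first nil     _       complete (a ∷ _) = preimage a , refl , λ i → ⊥-elim (¬distinct i (complete refl))
      first (_ ∙ _) (s , _) _        _       = s

-- The combinatorial argument

Block : Set
Block = ℕ → Bool

-- Spelled with the available gates, as is `choose`, so that the block operations of `logic` reduce
-- to `select` and `choose` by computation alone.
_⊕_ : Bool → Bool → Bool
a ⊕ b = not (a ∧ b) ∧ (a ∨ b)

⊕-self : ∀ a b → a ≡ b → a ⊕ b ≡ false
⊕-self false _ refl = refl
⊕-self true  _ refl = refl

⊕-≢ : ∀ a b → a ≢ b → a ⊕ b ≡ true
⊕-≢ false false ne = ⊥-elim (ne refl)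
⊕-≢ false true  ne = refl
⊕-≢ true  false ne = refl
⊕-≢ true  true  ne = ⊥-elim (ne refl)

⊕-false⁻ : ∀ a b → a ⊕ b ≡ false → a ≡ b
⊕-false⁻ false false _ = refl
⊕-false⁻ true  true  _ = refl

⊕-true⁻ : ∀ a b c → a ≢ b → a ⊕ c ≡ true → b ≡ c
⊕-true⁻ false false c     ne _ = ⊥-elim (ne refl)
⊕-true⁻ false true  true  ne _ = refl
⊕-true⁻ true  false false ne _ = refl
⊕-true⁻ true  true  c     ne _ = ⊥-elim (ne refl)

anyFrom : Block → ℕ → ℕ → Bool
anyFrom v j zero    = false
anyFrom v j (suc m) = v j ∨ anyFrom v (suc j) m

anyAbove : ℕ → Block → Block
anyAbove n v j = anyFrom v (suc j) (n ∸ suc j)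

lastTrue : ℕ → Block → Block
lastTrue n v j = not (anyAbove n v j) ∧ v j

-- For h ≢ y, whether z differs from h at the last position where y does.
select : ℕ → Block → Block → Block → Bool
select n h y z = chosen 0 ∨ anyAbove n chosen 0
  where
  chosen : Block
  chosen j = (h j ⊕ z j) ∧ lastTrue n (λ j → h j ⊕ y j) j

choose : Bool → Block → Block → Block
choose b h y j = (not b ∧ h j) ∨ (b ∧ y j)

anyFrom-false : ∀ v j m → (∀ k → j ≤ k → k < j + m → v k ≡ false) → anyFrom v j m ≡ false
anyFrom-false v j zero    h = refl
anyFrom-false v j (suc m) h
  rewrite h j ≤-refl (m<m+n j (s≤s z≤n)) =
  anyFrom-false v (suc j) m (λ k j<k k< → h k (<⇒≤ j<k) (subst (k <_) (sym (+-suc j m)) k<))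

anyFrom-true : ∀ v j m p → j ≤ p → p < j + m → v p ≡ true → anyFrom v j m ≡ true
anyFrom-true v j zero    p j≤p p< vp = ⊥-elim (<⇒≱ p< (subst (_≤ p) (sym (+-identityʳ j)) j≤p))
anyFrom-true v j (suc m) p j≤p p< vp with m≤n⇒m<n∨m≡n j≤p
... | inj₁ j<p  = trans (cong (v j ∨_) (anyFrom-true v (suc j) m p j<p (subst (p <_) (+-suc j m) p<) vp)) (∨-zeroʳ (v j))
... | inj₂ refl rewrite vp = refl

anyFrom-unique : ∀ v j m p → j ≤ p → p < j + m → (∀ k → j ≤ k → k < j + m → k ≢ p → v k ≡ false) →
                 anyFrom v j m ≡ v p
anyFrom-unique v j zero    p j≤p p< h = ⊥-elim (<⇒≱ p< (subst (_≤ p) (sym (+-identityʳ j)) j≤p))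
anyFrom-unique v j (suc m) p j≤p p< h with m≤n⇒m<n∨m≡n j≤p
... | inj₁ j<p rewrite h j ≤-refl (m<m+n j (s≤s z≤n)) (<⇒≢ j<p) =
  anyFrom-unique v (suc j) m p j<p (subst (p <_) (+-suc j m) p<)
    (λ k j<k k< → h k (<⇒≤ j<k) (subst (k <_) (sym (+-suc j m)) k<))
... | inj₂ refl rewrite anyFrom-false v (suc j) m
  (λ k j<k k< → h k (<⇒≤ j<k) (subst (k <_) (sym (+-suc j m)) k<) (≢-sym (<⇒≢ j<k))) = ∨-identityʳ (v j)

-- The bit `chosen k` can be true at `k = p` only: below `p` there is a difference further up,
-- namely `p`, and above `p` there is no difference. The disjunction collapses to its value at `p`.
select-last : ∀ n h y z p → p < n → h p ≢ y p → (∀ k → p < k → k < n → h k ≡ y k) →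
              select n h y z ≡ h p ⊕ z p
select-last n@(suc m) h y z p p<n hp≢yp same = trans (anyFrom-unique chosen 0 n p z≤n p<n elsewhere) at-p
  where
  differ chosen : Block
  differ j = h j ⊕ y j
  chosen j = (h j ⊕ z j) ∧ lastTrue n differ j
  below : ∀ {j k} → k < suc j + (n ∸ suc j) → j < n → k < n
  below {j} {k} k< j<n = subst (k <_) (m+[n∸m]≡n j<n) k<
  at-p : chosen p ≡ h p ⊕ z p
  at-p rewrite ⊕-≢ (h p) (y p) hp≢yp
             | anyFrom-false differ (suc p) (n ∸ suc p) (λ k p<k k< → ⊕-self (h k) (y k) (same k p<k (below k< p<n)))
             = ∧-identityʳ _
  elsewhere : ∀ k → 0 ≤ k → k < n → k ≢ p → chosen k ≡ false
  elsewhere k _ k<n k≢p with <-cmp k p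
  ... | tri< k<p _ _
    rewrite anyFrom-true differ (suc k) (n ∸ suc k) p k<p (subst (p <_) (sym (m+[n∸m]≡n k<n)) p<n) (⊕-≢ (h p) (y p) hp≢yp)
    = ∧-zeroʳ _
  ... | tri≈ _ k≡p _ = ⊥-elim (k≢p k≡p)
  ... | tri> _ _ p<k
    rewrite ⊕-self (h k) (y k) (same k p<k k<n)
          | ∧-zeroʳ (not (anyAbove n differ k)) = ∧-zeroʳ _

LastDifference : ℕ → Block → Block → Set
LastDifference n h y = ∃[ p ] (p < n × h p ≢ y p × ∀ k → p < k → k < n → h k ≡ y k)

extend : ∀ {n} {h y : Block} {k} → h n ≡ y n → k < suc n → (k < n → h k ≡ y k) → h k ≡ y k
extend eq k≤n same with m≤n⇒m<n∨m≡n (s≤s⁻¹ k≤n)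
... | inj₁ k<n  = same k<n
... | inj₂ refl = eq

lastDifference : ∀ n h y → (∀ k → k < n → h k ≡ y k) ⊎ LastDifference n h y
lastDifference zero    h y = inj₁ λ _ ()
lastDifference (suc n) h y with h n ≟ᵇ y n
... | no ne  = inj₂ (n , ≤-refl , ne , λ k n<k k≤n → ⊥-elim (<⇒≱ n<k (s≤s⁻¹ k≤n)))
... | yes eq with lastDifference n h y
...   | inj₁ same                  = inj₁ λ k k≤n → extend {h = h} {y} eq k≤n (same k)
...   | inj₂ (p , p<n , ne , same) = inj₂ (p , m≤n⇒m≤1+n p<n , ne , λ k p<k k≤n → extend {h = h} {y} eq k≤n (same k p<k))

hole : ℕ → (ℕ → Block) → ℕ → Block
hole n y zero    = λ _ → false
hole n y (suc i) = choose (select n (hole n y i) (y i) (y (suc i))) (hole n y i) (y i)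

module _ (n : ℕ) (y : ℕ → Block) where

  private
    H : ℕ → Block
    H = hole n y

    b : ℕ → Bool
    b i = select n (H i) (y i) (y (suc i))

  choose-false : ∀ {b} h z → b ≡ false → ∀ k → choose b h z k ≡ h k
  choose-false h z refl k = ∨-identityʳ (h k)

  choose-true : ∀ {b} h z → b ≡ true → ∀ k → choose b h z k ≡ z k
  choose-true h z refl k = refl

  -- A step keeps the hole or moves it to `y i`. A value `y j` with `j ≥ i` that equals `H i` would
  -- hence be zero or repeat an earlier value.
  hole-origin : ∀ i → (∀ k → H i k ≡ false) ⊎ ∃[ r ] (r < i × ∀ k → H i k ≡ y r k)
  hole-origin zero    = inj₁ λ _ → refl
  hole-origin (suc i) with b i in eq
  ... | true  = inj₂ (i , ≤-refl , choose-true (H i) (y i) refl)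
  ... | false with hole-origin i
  ...   | inj₁ zeros           = inj₁ λ k → trans (choose-false (H i) (y i) refl k) (zeros k)
  ...   | inj₂ (r , r<i , Hi≡) = inj₂ (r , m≤n⇒m≤1+n r<i , λ k → trans (choose-false (H i) (y i) refl k) (Hi≡ k))

  module _ (nonzero  : ∀ j → j ≤ n → ¬ (∀ k → k < n → y j k ≡ false))
           (distinct : ∀ i j → i < j → j ≤ n → ¬ (∀ k → k < n → y i k ≡ y j k))
           (constant : ∀ i j j′ → suc i < n → i < j → i < j′ → j ≤ n → j′ ≤ n →
                       select n (H i) (y i) (y j) ≡ select n (H i) (y i) (y j′))
    where

    private
      avoids-hole : ∀ i j → i ≤ j → j ≤ n → ¬ (∀ k → k < n → H i k ≡ y j k)
      avoids-hole i j i≤j j≤n same with hole-origin i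
      ... | inj₁ zeros           = nonzero j j≤n λ k k<n → trans (sym (same k k<n)) (zeros k)
      ... | inj₂ (r , r<i , Hi≡) = distinct r j (<-≤-trans r<i i≤j) j≤n λ k k<n → trans (sym (Hi≡ k)) (same k k<n)

      lastDiff : ∀ i j → i ≤ j → j ≤ n → LastDifference n (H i) (y j)
      lastDiff i j i≤j j≤n with lastDifference n (H i) (y j)
      ... | inj₁ same = ⊥-elim (avoids-hole i j i≤j j≤n same)
      ... | inj₂ d    = d

      Agree : ∀ {m} → Vec (Fin n) m → ℕ → ℕ → Set
      Agree ps i j = All (λ p → H i (toℕ p) ≡ y j (toℕ p)) ps

      -- Agreement on `ps` and disagreement at `p` exclude each other, so no bookkeeping of used
      -- positions is needed to keep them distinct.
      fresh : ∀ {m} {ps : Vec (Fin n) m} i j (p : Fin n) → H i (toℕ p) ≢ y j (toℕ p) → Agree ps i j → All (p ≢_) ps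
      fresh i j p ne = All.map λ { agree refl → ne agree }

      -- By constancy, all later `y j` have the same bit at the new position. If it is the bit of
      -- the hole, the hole stays. Otherwise it is the bit of `y i`, there being only two, and the
      -- hole moves there; the old positions survive the move because `y i` agrees with the old hole
      -- on them.
      agreement : ∀ i → i ≤ n → Σ (Vec (Fin n) i) λ ps → Unique ps × (∀ j → i ≤ j → j ≤ n → Agree ps i j)
      agreement zero    _   = [] , [] , λ _ _ _ → []
      agreement (suc i) i<n with agreement i (<⇒≤ i<n) | lastDiff i i ≤-refl (<⇒≤ i<n)
      ... | ps , unique , agree | p , p<n , ne , same = p′ ∷ ps , fresh i i p′ ne′ (agree i ≤-refl (<⇒≤ i<n)) ∷ unique , step
        where
        p′ = fromℕ< p<n
        p≡ : toℕ p′ ≡ p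
        p≡ = toℕ-fromℕ< p<n
        ne′ : H i (toℕ p′) ≢ y i (toℕ p′)
        ne′ rewrite p≡ = ne
        b≡ : ∀ j → i < j → j ≤ n → H i (toℕ p′) ⊕ y j (toℕ p′) ≡ b i
        b≡ j i<j j≤n rewrite p≡ = trans (sym (select-last n (H i) (y i) (y j) p p<n ne same)) j-irrelevant
          where
          j-irrelevant : select n (H i) (y i) (y j) ≡ b i
          j-irrelevant with m≤n⇒m<n∨m≡n i<n
          ... | inj₁ i+1<n = constant i j (suc i) i+1<n i<j ≤-refl j≤n i<n
          -- Here `suc i` is `n`, for which there is no predicate, but `i < j ≤ n` leaves only one
          -- `j`.
          ... | inj₂ refl  = cong (λ j → select n (H i) (y i) (y j)) (≤-antisym j≤n i<j)
        step : ∀ j → suc i ≤ j → j ≤ n → Agree (p′ ∷ ps) (suc i) j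
        step j i<j j≤n with b i in eq
        ... | false = trans (kept (toℕ p′)) (⊕-false⁻ _ _ (trans (b≡ j i<j j≤n) eq)) ∷
                      All.map (λ {q} → trans (kept (toℕ q))) (agree j (<⇒≤ i<j) j≤n)
          where
          kept = choose-false (H i) (y i) refl
        ... | true  = trans (moved (toℕ p′)) (⊕-true⁻ _ _ _ ne′ (trans (b≡ j i<j j≤n) eq)) ∷
                      All.map (λ {q} (eqᵢ , eqⱼ) → trans (moved (toℕ q)) (trans (sym eqᵢ) eqⱼ))
                        (All.zip (agree i ≤-refl (<⇒≤ i<n) , agree j (<⇒≤ i<j) j≤n))
          where
          moved = choose-true (H i) (y i) refl

    -- The value `y n` agrees with `H n` on `n` distinct positions and yet differs from it
    -- somewhere, at a position that must be fresh. That makes `n + 1` distinct elements of `Fin n`.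
    no-long-choice : ⊥
    no-long-choice with agreement n ≤-refl | lastDiff n n ≤-refl ≤-refl
    ... | ps , unique , agree | p , p<n , ne , _ =
      <⇒≱ (n<1+n n) (injective⇒≤ (λ {i} {j} → lookup-injective unique⁺ i j))
      where
      ne′ : H n (toℕ (fromℕ< p<n)) ≢ y n (toℕ (fromℕ< p<n))
      ne′ rewrite toℕ-fromℕ< p<n = ne
      unique⁺ : Unique (fromℕ< p<n ∷ ps)
      unique⁺ = fresh n n (fromℕ< p<n) ne′ (agree n ≤-refl ≤-refl) ∷ unique

-- Untyped gates

-- `Gates` carries wire counts in its type, so concatenating and repeating code would need
-- transports throughout. Plain numbers as indices, with scoping as a separate predicate, keep code
-- an ordinary list.
data RawGate : Set where
  constʳ    : Bool → RawGate
  negʳ      : ℕ → RawGate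
  andʳ orʳ  : ℕ → ℕ → RawGate

Code : Set
Code = List RawGate

evalRaw : RawGate → (ℕ → Bool) → Bool
evalRaw (constʳ b) ρ = b
evalRaw (negʳ i)   ρ = not (ρ i)
evalRaw (andʳ i j) ρ = ρ i ∧ ρ j
evalRaw (orʳ i j)  ρ = ρ i ∨ ρ j

infixr 5 _◂_

_◂_ : ∀ {A : Set} → A → (ℕ → A) → ℕ → A
(a ◂ ρ) zero    = a
(a ◂ ρ) (suc k) = ρ k

exec : Code → (ℕ → Bool) → ℕ → Bool
exec []       ρ = ρ
exec (g ∷ gs) ρ = exec gs (evalRaw g ρ ◂ ρ)

exec-++ : ∀ gs hs ρ → exec (gs ++ hs) ρ ≡ exec hs (exec gs ρ)
exec-++ []       hs ρ = refl
exec-++ (g ∷ gs) hs ρ = exec-++ gs hs (evalRaw g ρ ◂ ρ)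

exec-old : ∀ gs ρ k → exec gs ρ (length gs + k) ≡ ρ k
exec-old []       ρ k = refl
exec-old (g ∷ gs) ρ k =
  trans (cong (exec gs (evalRaw g ρ ◂ ρ)) (sym (+-suc (length gs) k))) (exec-old gs (evalRaw g ρ ◂ ρ) (suc k))

InScope₁ : ℕ → RawGate → Set
InScope₁ w (constʳ b) = ⊤
InScope₁ w (negʳ i)   = i < w
InScope₁ w (andʳ i j) = i < w × j < w
InScope₁ w (orʳ i j)  = i < w × j < w

InScope : ℕ → Code → Set
InScope w []       = ⊤
InScope w (g ∷ gs) = InScope₁ w g × InScope (suc w) gs

inScope₁-mono : ∀ {w w′} g → w ≤ w′ → InScope₁ w g → InScope₁ w′ g
inScope₁-mono (constʳ b) le _         = tt
inScope₁-mono (negʳ i)   le i<        = <-≤-trans i< le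
inScope₁-mono (andʳ i j) le (i< , j<) = <-≤-trans i< le , <-≤-trans j< le
inScope₁-mono (orʳ i j)  le (i< , j<) = <-≤-trans i< le , <-≤-trans j< le

inScope-mono : ∀ {w w′} gs → w ≤ w′ → InScope w gs → InScope w′ gs
inScope-mono []       le _         = tt
inScope-mono (g ∷ gs) le (ok , oks) = inScope₁-mono g le ok , inScope-mono gs (s≤s le) oks

inScope-++ : ∀ {w} gs hs → InScope w gs → InScope (length gs + w) hs → InScope w (gs ++ hs)
inScope-++ []       hs _          oks′ = oks′
inScope-++ {w} (g ∷ gs) hs (ok , oks) oks′ =
  ok , inScope-++ gs hs oks (subst (λ w → InScope w hs) (sym (+-suc (length gs) w)) oks′)

inScope-replicate : ∀ {w} c g → InScope₁ w g → InScope w (replicate c g)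
inScope-replicate zero    g ok = tt
inScope-replicate (suc c) g ok = ok , inScope-replicate c g (inScope₁-mono g (n≤1+n _) ok)

rawGate : ∀ {w} → Gate w → RawGate
rawGate (const b) = constʳ b
rawGate (neg i)   = negʳ (toℕ i)
rawGate (and i j) = andʳ (toℕ i) (toℕ j)
rawGate (or i j)  = orʳ (toℕ i) (toℕ j)

raw : ∀ {w w′} → Gates w w′ → Code
raw []       = []
raw (g ∷ gs) = rawGate g ∷ raw gs

toGate : ∀ {w} g → InScope₁ w g → Gate w
toGate (constʳ b) _         = const b
toGate (negʳ i)   i<        = neg (fromℕ< i<)
toGate (andʳ i j) (i< , j<) = and (fromℕ< i<) (fromℕ< j<)
toGate (orʳ i j)  (i< , j<) = or (fromℕ< i<) (fromℕ< j<)

wiresAfter : ℕ → Code → ℕ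
wiresAfter w []       = w
wiresAfter w (g ∷ gs) = wiresAfter (suc w) gs

wiresAfter≡ : ∀ w gs → wiresAfter w gs ≡ length gs + w
wiresAfter≡ w []       = refl
wiresAfter≡ w (g ∷ gs) = trans (wiresAfter≡ (suc w) gs) (+-suc (length gs) w)

toGates : ∀ {w} gs → InScope w gs → Gates w (wiresAfter w gs)
toGates []       _          = []
toGates (g ∷ gs) (ok , oks) = toGate g ok ∷ toGates gs oks

rawGate-toGate : ∀ {w} g (ok : InScope₁ w g) → rawGate (toGate g ok) ≡ g
rawGate-toGate (constʳ b) _         = refl
rawGate-toGate (negʳ i)   i<        = cong negʳ (toℕ-fromℕ< i<)
rawGate-toGate (andʳ i j) (i< , j<) = cong₂ andʳ (toℕ-fromℕ< i<) (toℕ-fromℕ< j<)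
rawGate-toGate (orʳ i j)  (i< , j<) = cong₂ orʳ (toℕ-fromℕ< i<) (toℕ-fromℕ< j<)

raw-toGates : ∀ {w} gs (oks : InScope w gs) → raw (toGates gs oks) ≡ gs
raw-toGates []       _          = refl
raw-toGates (g ∷ gs) (ok , oks) = cong₂ _∷_ (rawGate-toGate g ok) (raw-toGates gs oks)

inScope₁-raw : ∀ {w} (g : Gate w) → InScope₁ w (rawGate g)
inScope₁-raw (const b) = tt
inScope₁-raw (neg i)   = toℕ<n i
inScope₁-raw (and i j) = toℕ<n i , toℕ<n j
inScope₁-raw (or i j)  = toℕ<n i , toℕ<n j

inScope-raw : ∀ {w w′} (gs : Gates w w′) → InScope w (raw gs)
inScope-raw []       = tt
inScope-raw (g ∷ gs) = inScope₁-raw g , inScope-raw gs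

length-raw : ∀ {w w′} (gs : Gates w w′) → length (raw gs) ≡ gateCount gs
length-raw []       = refl
length-raw (g ∷ gs) = cong suc (length-raw gs)

wires-raw : ∀ {w w′} (gs : Gates w w′) → w′ ≡ length (raw gs) + w
wires-raw []               = refl
wires-raw {w} (g ∷ gs) = trans (wires-raw gs) (+-suc (length (raw gs)) w)

evalGate-raw : ∀ {w} (g : Gate w) v ρ → (∀ i → lookup v i ≡ ρ (toℕ i)) → evalGate g v ≡ evalRaw (rawGate g) ρ
evalGate-raw (const b) v ρ eq = refl
evalGate-raw (neg i)   v ρ eq = cong not (eq i)
evalGate-raw (and i j) v ρ eq = cong₂ _∧_ (eq i) (eq j)
evalGate-raw (or i j)  v ρ eq = cong₂ _∨_ (eq i) (eq j)

evalGates-raw : ∀ {w w′} (gs : Gates w w′) v ρ → (∀ i → lookup v i ≡ ρ (toℕ i)) →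
                ∀ i → lookup (evalGates gs v) i ≡ exec (raw gs) ρ (toℕ i)
evalGates-raw []       v ρ eq = eq
evalGates-raw (g ∷ gs) v ρ eq = evalGates-raw gs (evalGate g v ∷ v) (evalRaw (rawGate g) ρ ◂ ρ)
  λ { zero → evalGate-raw g v ρ eq ; (suc i) → eq i }

-- Repeated gates acting on blocks

replicate-snoc : ∀ {A : Set} c (x : A) → replicate (suc c) x ≡ replicate c x ++ [ x ]
replicate-snoc zero    x = refl
replicate-snoc (suc c) x = cong (x ∷_) (replicate-snoc c x)

exec-snoc : ∀ c g ρ k → exec (replicate (suc c) g) ρ k ≡
            (evalRaw g (exec (replicate c g) ρ) ◂ exec (replicate c g) ρ) k
exec-snoc c g ρ k = trans (cong (λ gs → exec gs ρ k) (replicate-snoc c g))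
  (cong (λ f → f k) (exec-++ (replicate c g) [ g ] ρ))

exec-replicate-old : ∀ c g ρ k → exec (replicate c g) ρ (c + k) ≡ ρ k
exec-replicate-old c g ρ k =
  trans (cong (λ l → exec (replicate c g) ρ (l + k)) (sym (length-replicate c))) (exec-old (replicate c g) ρ k)

-- Repeating a gate with fixed wire indices applies it to whole blocks of
-- wires, from the last bit to the first, since each new wire shifts the
-- indices of the old ones by one.
wire-shifted : ∀ c p g ρ → exec (replicate c g) ρ (p + c) ≡ ρ (p + 0)
wire-shifted c p g ρ = trans (cong (exec (replicate c g) ρ) (+-comm p c))
    (trans (exec-replicate-old c g ρ p) (cong ρ (sym (+-identityʳ p))))

exec-neg : ∀ c p ρ j → j ≤ c → exec (replicate (suc c) (negʳ (p + c))) ρ j ≡ not (ρ (p + j))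
exec-neg c p ρ zero j≤ = trans (exec-snoc c _ ρ 0) (cong not (wire-shifted c p _ ρ))
-- Without the newest wire, bit `suc j` becomes bit `j` of one repetition fewer. The gate index is
-- unchanged, and `p + suc c` is read as `suc p + c`.
exec-neg (suc c) p ρ (suc j) (s≤s j≤) = trans (exec-snoc (suc c) _ ρ (suc j))
  (trans (cong (λ e → exec (replicate (suc c) (negʳ e)) ρ j) (+-suc p c))
    (trans (exec-neg c (suc p) ρ j j≤) (cong (λ k → not (ρ k)) (sym (+-suc p j)))))

exec-and : ∀ c p q ρ j → j ≤ c → exec (replicate (suc c) (andʳ (p + c) (q + c))) ρ j ≡ ρ (p + j) ∧ ρ (q + j)
exec-and c p q ρ zero j≤ = trans (exec-snoc c _ ρ 0) (cong₂ _∧_ (wire-shifted c p _ ρ) (wire-shifted c q _ ρ))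
exec-and (suc c) p q ρ (suc j) (s≤s j≤) = trans (exec-snoc (suc c) _ ρ (suc j))
  (trans (cong₂ (λ e f → exec (replicate (suc c) (andʳ e f)) ρ j) (+-suc p c) (+-suc q c))
    (trans (exec-and c (suc p) (suc q) ρ j j≤) (cong₂ (λ k l → ρ k ∧ ρ l) (sym (+-suc p j)) (sym (+-suc q j)))))

exec-or : ∀ c p q ρ j → j ≤ c → exec (replicate (suc c) (orʳ (p + c) (q + c))) ρ j ≡ ρ (p + j) ∨ ρ (q + j)
exec-or c p q ρ zero j≤ = trans (exec-snoc c _ ρ 0) (cong₂ _∨_ (wire-shifted c p _ ρ) (wire-shifted c q _ ρ))
exec-or (suc c) p q ρ (suc j) (s≤s j≤) = trans (exec-snoc (suc c) _ ρ (suc j))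
  (trans (cong₂ (λ e f → exec (replicate (suc c) (orʳ e f)) ρ j) (+-suc p c) (+-suc q c))
    (trans (exec-or c (suc p) (suc q) ρ j j≤) (cong₂ (λ k l → ρ k ∨ ρ l) (sym (+-suc p j)) (sym (+-suc q j)))))

-- Each gate copies the newest wire, so all copies equal the original, which ends up at index `c`.
exec-spread : ∀ c ρ j → j ≤ c → exec (replicate c (orʳ 0 0)) ρ j ≡ ρ 0
exec-spread zero    ρ zero    _  = refl
exec-spread (suc c) ρ zero    j≤ = trans (exec-snoc c _ ρ 0) (trans (∨-idem _) (exec-spread c ρ 0 z≤n))
exec-spread (suc c) ρ (suc j) (s≤s j≤) = trans (exec-snoc c _ ρ (suc j)) (exec-spread c ρ j j≤)

anyFrom-suc : ∀ v j m → anyFrom (λ k → v (suc k)) j m ≡ anyFrom v (suc j) m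
anyFrom-suc v j zero    = refl
anyFrom-suc v j (suc m) = cong (v (suc j) ∨_) (anyFrom-suc v (suc j) m)

anyFrom-cong : ∀ u v j m → (∀ k → k < j + m → u k ≡ v k) → anyFrom u j m ≡ anyFrom v j m
anyFrom-cong u v j zero    eq = refl
anyFrom-cong u v j (suc m) eq =
  cong₂ _∨_ (eq j (m<m+n j (s≤s z≤n))) (anyFrom-cong u v (suc j) m (λ k k< → eq k (subst (k <_) (sym (+-suc j m)) k<)))

-- The newest wire accumulates a disjunction while the shifting index walks down the block. The seed
-- `ρ 0`, the empty disjunction, ends up at index `c`.
exec-any : ∀ c p ρ j → ρ 0 ≡ false → j ≤ c →
           exec (replicate c (orʳ (p + c) 0)) ρ j ≡ anyFrom (λ k → ρ (suc p + k)) j (c ∸ j)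
exec-any zero    p ρ zero ρ0 _  = ρ0
exec-any (suc c) p ρ zero ρ0 j≤ = trans (exec-snoc c _ ρ 0) (cong₂ _∨_
  (trans (cong (exec (replicate c _) ρ) (trans (+-suc p c) (trans (+-comm (suc p) c) refl)))
    (trans (exec-replicate-old c _ ρ (suc p)) (cong ρ (sym (+-identityʳ (suc p))))))
  (trans (cong (λ e → exec (replicate c (orʳ e 0)) ρ 0) (+-suc p c))
    (trans (exec-any c (suc p) ρ 0 ρ0 z≤n) (tail 0 c))))
  where
  tail : ∀ j m → anyFrom (λ k → ρ (2 + p + k)) j m ≡ anyFrom (λ k → ρ (suc p + k)) (suc j) m
  tail j m = trans (anyFrom-cong _ (λ k → ρ (suc p + suc k)) j m (λ k _ → cong ρ (sym (+-suc (suc p) k))))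
    (anyFrom-suc (λ k → ρ (suc p + k)) j m)
exec-any (suc c) p ρ (suc j) ρ0 (s≤s j≤) = trans (exec-snoc c _ ρ (suc j))
  (trans (cong (λ e → exec (replicate c (orʳ e 0)) ρ j) (+-suc p c))
    (trans (exec-any c (suc p) ρ j ρ0 j≤) (tail j (c ∸ j))))
  where
  tail : ∀ j m → anyFrom (λ k → ρ (2 + p + k)) j m ≡ anyFrom (λ k → ρ (suc p + k)) (suc j) m
  tail j m = trans (anyFrom-cong _ (λ k → ρ (suc p + suc k)) j m (λ k _ → cong ρ (sym (+-suc (suc p) k))))
    (anyFrom-suc (λ k → ρ (suc p + k)) j m)

-- A stack machine on blocks of n bits: each operation reads blocks at given
-- depths and pushes one block.
data Op : Set where
  notᵇ       : ℕ → Op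
  andᵇ orᵇ   : ℕ → ℕ → Op
  aboveᵇ     : ℕ → Op
  spreadᵇ    : Op

opCode : ℕ → Op → Code
opCode n (notᵇ k)   = replicate n (negʳ (k * n + pred n))
opCode n (andᵇ k l) = replicate n (andʳ (k * n + pred n) (l * n + pred n))
opCode n (orᵇ k l)  = replicate n (orʳ (k * n + pred n) (l * n + pred n))
-- Nothing lies above the last bit, so `false` is its value and the seed of the others. It is one of
-- the `n` wires and shifts the older ones, hence `pred n` repetitions and the `suc` in the index.
opCode n (aboveᵇ k) = constʳ false ∷ replicate (pred n) (orʳ (suc (k * n) + pred n) 0)
opCode n spreadᵇ    = replicate n (orʳ 0 0)

runOp : ℕ → Op → (ℕ → Block) → Block
runOp n (notᵇ k)   σ = λ j → not (σ k j)
runOp n (andᵇ k l) σ = λ j → σ k j ∧ σ l j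
runOp n (orᵇ k l)  σ = λ j → σ k j ∨ σ l j
runOp n (aboveᵇ k) σ = anyAbove n (σ k)
runOp n spreadᵇ    σ = λ j → σ 0 0

opsCode : ℕ → List Op → Code
opsCode n []         = []
opsCode n (op ∷ ops) = opCode n op ++ opsCode n ops

runOps : ℕ → List Op → (ℕ → Block) → ℕ → Block
runOps n []         σ = σ
runOps n (op ∷ ops) σ = runOps n ops (runOp n op σ ◂ σ)

Models : ℕ → (ℕ → Bool) → (ℕ → Block) → Set
Models n ρ σ = ∀ k j → j < n → ρ (k * n + j) ≡ σ k j

length-opCode : ∀ n op → 0 < n → length (opCode n op) ≡ n
length-opCode n       (notᵇ k)   _ = length-replicate n
length-opCode n       (andᵇ k l) _ = length-replicate n
length-opCode n       (orᵇ k l)  _ = length-replicate n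
length-opCode (suc m) (aboveᵇ k) _ = cong suc (length-replicate m)
length-opCode n       spreadᵇ    _ = length-replicate n

exec-op-top : ∀ n op ρ σ → Models n ρ σ → ∀ j → j < n → exec (opCode n op) ρ j ≡ runOp n op σ j
exec-op-top n@(suc m) (notᵇ k) ρ σ mod j j<n =
  trans (exec-neg m (k * n) ρ j (s≤s⁻¹ j<n)) (cong not (mod k j j<n))
exec-op-top n@(suc m) (andᵇ k l) ρ σ mod j j<n =
  trans (exec-and m (k * n) (l * n) ρ j (s≤s⁻¹ j<n)) (cong₂ _∧_ (mod k j j<n) (mod l j j<n))
exec-op-top n@(suc m) (orᵇ k l) ρ σ mod j j<n =
  trans (exec-or m (k * n) (l * n) ρ j (s≤s⁻¹ j<n)) (cong₂ _∨_ (mod k j j<n) (mod l j j<n))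
exec-op-top n@(suc m) (aboveᵇ k) ρ σ mod j j<n =
  trans (exec-any m (suc (k * n)) (false ◂ ρ) j refl (s≤s⁻¹ j<n))
    (trans (anyFrom-cong _ (λ i → σ k (suc i)) j (m ∸ j)
      (λ i i< → trans (cong ρ (sym (+-suc (k * n) i))) (mod k (suc i) (s≤s (subst (i <_) (m+[n∸m]≡n (s≤s⁻¹ j<n)) i<)))))
      (anyFrom-suc (σ k) j (m ∸ j)))
exec-op-top n@(suc m) spreadᵇ ρ σ mod j j<n =
  trans (exec-spread n ρ j (<⇒≤ j<n)) (mod 0 0 (s≤s z≤n))

push-models : ∀ n gs ρ σ B → length gs ≡ n → Models n ρ σ → (∀ j → j < n → exec gs ρ j ≡ B j) →
              Models n (exec gs ρ) (B ◂ σ)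
push-models n gs ρ σ B len mod top zero    j j<n = top j j<n
push-models n gs ρ σ B len mod top (suc k) j j<n =
  trans (cong (exec gs ρ) (trans (+-assoc n (k * n) j) (cong (_+ (k * n + j)) (sym len))))
    (trans (exec-old gs ρ (k * n + j)) (mod k j j<n))

exec-ops : ∀ n ops ρ σ → 0 < n → Models n ρ σ → Models n (exec (opsCode n ops) ρ) (runOps n ops σ)
exec-ops n []         ρ σ n>0 mod = mod
exec-ops n (op ∷ ops) ρ σ n>0 mod rewrite exec-++ (opCode n op) (opsCode n ops) ρ =
  exec-ops n ops _ _ n>0
    (push-models n (opCode n op) ρ σ _ (length-opCode n op n>0) mod (exec-op-top n op ρ σ mod))

-- On top of the blocks h, y and z, pushes 19 blocks; the last one is the new
-- hole, and select n h y z fills the block at depth 4.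
logic : List Op
logic =
  andᵇ 0 1 ∷ orᵇ 1 2 ∷ notᵇ 1 ∷ andᵇ 0 1 ∷
  aboveᵇ 0 ∷ notᵇ 0 ∷ andᵇ 0 2 ∷
  andᵇ 7 9 ∷ orᵇ 8 10 ∷ notᵇ 1 ∷ andᵇ 0 1 ∷
  andᵇ 0 4 ∷ aboveᵇ 0 ∷ orᵇ 1 0 ∷ spreadᵇ ∷
  andᵇ 0 16 ∷ notᵇ 1 ∷ andᵇ 0 17 ∷ orᵇ 0 2 ∷ []

-- The predicates

nthOr : ∀ {A : Set} {n} → A → Vec A n → ℕ → A
nthOr d []       k       = d
nthOr d (x ∷ xs) zero    = x
nthOr d (x ∷ xs) (suc k) = nthOr d xs k

nthOr-lookup : ∀ {A : Set} {n} d (v : Vec A n) i → nthOr d v (toℕ i) ≡ lookup v i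
nthOr-lookup d (x ∷ xs) zero    = refl
nthOr-lookup d (x ∷ xs) (suc i) = nthOr-lookup d xs i

nthOr-< : ∀ {A : Set} {n} d (v : Vec A n) {k} (k<n : k < n) → nthOr d v k ≡ lookup v (fromℕ< k<n)
nthOr-< d v k<n = trans (cong (nthOr d v) (sym (toℕ-fromℕ< k<n))) (nthOr-lookup d v (fromℕ< k<n))

bits : ∀ {n} → U n → Block
bits = nthOr false

-- There is no identity gate, so a wire is copied by its disjunction with itself. Copies bring
-- blocks back to multiples of `n` once the gates of `C`, of which there may be any number, have
-- broken the alignment.
copyCode : ℕ → ℕ → Code
copyCode n o = replicate n (orʳ (o + pred n) (o + pred n))

exec-copy : ∀ n o ρ j → j < n → exec (copyCode n o) ρ j ≡ ρ (o + j)
exec-copy (suc m) o ρ j j<n = trans (exec-or m o o ρ j (s≤s⁻¹ j<n)) (∨-idem _)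

-- Emitted from the last output to the first, so that output 0 ends up at index 0. When the gate for
-- the head is added, `o` wires have already been pushed, which explains the shift.
outputsCode : ∀ {w o} → Vec (Fin w) o → Code
outputsCode []                   = []
outputsCode {o = suc o} (i ∷ is) = outputsCode is ++ [ orʳ (toℕ i + o) (toℕ i + o) ]

length-outputsCode : ∀ {w o} (is : Vec (Fin w) o) → length (outputsCode is) ≡ o
length-outputsCode []       = refl
length-outputsCode {o = suc o} (i ∷ is) =
  trans (length-++ (outputsCode is)) (trans (+-comm (length (outputsCode is)) 1) (cong suc (length-outputsCode is)))

exec-outputs : ∀ {w o} (is : Vec (Fin w) o) ρ j → exec (outputsCode is) ρ (toℕ j) ≡ ρ (toℕ (lookup is j))
exec-outputs {o = suc o} (i ∷ is) ρ zero
  rewrite exec-++ (outputsCode is) [ orʳ (toℕ i + o) (toℕ i + o) ] ρ =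
  trans (∨-idem _) (trans (cong (exec (outputsCode is) ρ)
    (trans (+-comm (toℕ i) o) (cong (_+ toℕ i) (sym (length-outputsCode is)))))
    (exec-old (outputsCode is) ρ (toℕ i)))
exec-outputs {o = suc o} (i ∷ is) ρ (suc j)
  rewrite exec-++ (outputsCode is) [ orʳ (toℕ i + o) (toℕ i + o) ] ρ = exec-outputs is ρ j

Below : ℕ → Op → Set
Below b (notᵇ k)   = k < b
Below b (andᵇ k l) = k < b × l < b
Below b (orᵇ k l)  = k < b × l < b
Below b (aboveᵇ k) = k < b
Below b spreadᵇ    = 0 < b

last< : ∀ n {k b w} → 0 < n → k < b → b * n ≤ w → k * n + pred n < w
last< n@(suc m) {k} {b} n>0 k<b le =
  <-≤-trans (subst (k * n + m <_) (+-comm (k * n) n) (+-monoʳ-< (k * n) (n<1+n m))) (≤-trans (*-monoˡ-≤ n k<b) le)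

inScope-op : ∀ n op {b w} → 0 < n → Below b op → b * n ≤ w → InScope w (opCode n op)
inScope-op n (notᵇ k)   n>0 k<         le = inScope-replicate n _ (last< n n>0 k< le)
inScope-op n (andᵇ k l) n>0 (k< , l<)  le = inScope-replicate n _ (last< n n>0 k< le , last< n n>0 l< le)
inScope-op n (orᵇ k l)  n>0 (k< , l<)  le = inScope-replicate n _ (last< n n>0 k< le , last< n n>0 l< le)
inScope-op n (aboveᵇ k) n>0 k<         le = tt , inScope-replicate (pred n) _ (s≤s (last< n n>0 k< le) , s≤s z≤n)
inScope-op n spreadᵇ {b} n>0 b>0       le = inScope-replicate n _ (0< , 0<)
  where 0< = <-≤-trans (*-mono-≤ b>0 n>0) le

inScope-ops : ∀ n ops {b w} → 0 < n → ListAll.All (Below b) ops → b * n ≤ w → InScope w (opsCode n ops)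
inScope-ops n []         n>0 []         le = tt
inScope-ops n (op ∷ ops) n>0 (bl ∷ bls) le =
  inScope-++ (opCode n op) (opsCode n ops) (inScope-op n op n>0 bl le) (inScope-ops n ops n>0 bls (≤-trans le (m≤n+m _ _)))

length-opsCode : ∀ n ops → 0 < n → length (opsCode n ops) ≡ length ops * n
length-opsCode n []         n>0 = refl
length-opsCode n (op ∷ ops) n>0 =
  trans (length-++ (opCode n op)) (cong₂ _+_ (length-opCode n op n>0) (length-opsCode n ops n>0))

-- The initial zeros guarantee 22 older blocks before any operation runs, so one fixed bound serves
-- all operations and is decided by computation.
logic-below : ListAll.All (Below 22) logic
logic-below = toWitness {a? = ListAll.all? (below? 22) logic} tt
  where
  below? : ∀ b op → Dec (Below b op)
  below? b (notᵇ k)   = k <? b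
  below? b (andᵇ k l) = k <? b ×-dec l <? b
  below? b (orᵇ k l)  = k <? b ×-dec l <? b
  below? b (aboveᵇ k) = k <? b
  below? b spreadᵇ    = 0 <? b

inScope-copy : ∀ n o {w} → o + n ≤ w → InScope w (copyCode n o)
inScope-copy zero    o le = tt
inScope-copy (suc m) o le = inScope-replicate (suc m) _ (o< , o<)
  where o< = <-≤-trans (+-monoʳ-< o (n<1+n m)) le

inScope-outputs : ∀ {w o w′} (is : Vec (Fin w) o) → w ≤ w′ → InScope w′ (outputsCode is)
inScope-outputs []       le = tt
inScope-outputs {w} {suc o} {w′} (i ∷ is) le = inScope-++ (outputsCode is) _ (inScope-outputs is le) ((i< , i<) , tt)
  where
  i< : toℕ i + o < length (outputsCode is) + w′
  i< rewrite length-outputsCode is = subst (_< o + w′) (+-comm o (toℕ i)) (+-monoʳ-< o (<-≤-trans (toℕ<n i) le))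

module _ {n : ℕ} (C : Circuit n n) where

  -- The gates of C are copied verbatim: their indices stay valid in front of
  -- any further wires, as long as the input of C is the frontmost block.
  bodyCode : Code
  bodyCode = raw (gates C) ++ outputsCode (outputs C) ++ copyCode n (length (raw (gates C)) + 23 * n) ++
             copyCode n (length (raw (gates C)) + 3 * n) ++ opsCode n logic

  stepCode : ℕ → Code
  stepCode o = copyCode n o ++ bodyCode

  -- The index of input block `s` after `codeUpTo s`. From one step to the next it grows by the
  -- `n + length bodyCode` wires of the step, and by another `n` because the next input lies one
  -- block deeper.
  source : ℕ → ℕ
  source s = 22 * n + s * (n + (n + length bodyCode))

  -- Between two steps, the frontmost block is the hole and the block at
  -- depth 21 is the value of C at the input block processed last.
  codeUpTo : ℕ → Code
  codeUpTo zero    = replicate (22 * n) (constʳ false)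
  codeUpTo (suc s) = codeUpTo s ++ stepCode (source s)

  length-stepCode : ∀ o → length (stepCode o) ≡ n + length bodyCode
  length-stepCode o = trans (length-++ (copyCode n o)) (cong (_+ length bodyCode) (length-replicate n))

  length-codeUpTo : ∀ s → length (codeUpTo s) ≡ 22 * n + s * (n + length bodyCode)
  length-codeUpTo zero    = trans (length-replicate (22 * n)) (sym (+-identityʳ _))
  length-codeUpTo (suc s) = begin
    length (codeUpTo s ++ stepCode (source s))            ≡⟨ length-++ (codeUpTo s) ⟩
    length (codeUpTo s) + length (stepCode (source s))    ≡⟨ cong₂ _+_ (length-codeUpTo s) (length-stepCode (source s)) ⟩
    22 * n + s * L + L                                    ≡⟨ +-assoc (22 * n) (s * L) L ⟩
    22 * n + (s * L + L)                                  ≡⟨ cong (22 * n +_) (+-comm (s * L) L) ⟩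
    22 * n + suc s * L                                    ∎
    where
    open ≡-Reasoning
    L = n + length bodyCode

  source≡ : ∀ s → source s ≡ length (codeUpTo s) + s * n
  source≡ s = begin
    22 * n + s * (n + L)          ≡⟨ arrange (22 * n) s n L ⟩
    22 * n + s * L + s * n        ≡⟨ cong (_+ s * n) (length-codeUpTo s) ⟨
    length (codeUpTo s) + s * n   ∎
    where
    open ≡-Reasoning
    L = n + length bodyCode
    arrange : ∀ a s n l → a + s * (n + l) ≡ a + s * l + s * n
    arrange = solve-∀

  private
    G = length (raw (gates C))

  -- The 22 blocks are the outputs of `C`, the two copies and the 19 blocks pushed by `logic`.
  length-bodyCode : 0 < n → length bodyCode ≡ G + 22 * n
  length-bodyCode n>0
    rewrite length-++ (raw (gates C)) {outputsCode (outputs C) ++ copyCode n (G + 23 * n) ++ copyCode n (G + 3 * n) ++ opsCode n logic}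
          | length-++ (outputsCode (outputs C)) {copyCode n (G + 23 * n) ++ copyCode n (G + 3 * n) ++ opsCode n logic}
          | length-++ (copyCode n (G + 23 * n)) {copyCode n (G + 3 * n) ++ opsCode n logic}
          | length-++ (copyCode n (G + 3 * n)) {opsCode n logic}
          | length-outputsCode (outputs C)
          | length-replicate n {orʳ (G + 23 * n + pred n) (G + 23 * n + pred n)}
          | length-replicate n {orʳ (G + 3 * n + pred n) (G + 3 * n + pred n)}
          | length-opsCode n logic n>0 = refl

  inScope-body : ∀ {w} → 0 < n → 22 * n ≤ w → InScope (n + w) bodyCode
  inScope-body {w} n>0 le =
    inScope-++ (raw (gates C)) _ (inScope-mono (raw (gates C)) (m≤m+n n w) (inScope-raw (gates C)))
      (inScope-++ (outputsCode (outputs C)) _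
        (inScope-outputs (outputs C) (≤-trans (≤-reflexive (wires-raw (gates C))) (+-monoʳ-≤ G (m≤m+n n w))))
        (inScope-++ (copyCode n (G + 23 * n)) _ (inScope-copy n (G + 23 * n) copy₁)
          (inScope-++ (copyCode n (G + 3 * n)) _ (inScope-copy n (G + 3 * n) copy₂)
            (inScope-ops n logic n>0 logic-below (≤-trans le (below (length (copyCode n (G + 3 * n))) (length (copyCode n (G + 23 * n))) (length (outputsCode (outputs C))) G n w))))))
    where
    open ≤-Reasoning
    below : ∀ a b c d e f → f ≤ a + (b + (c + (d + (e + f))))
    below a b c d e f = ≤-trans (m≤n+m f e) (≤-trans (m≤n+m _ d) (≤-trans (m≤n+m _ c) (≤-trans (m≤n+m _ b) (m≤n+m _ a))))
    copy₁ : G + 23 * n + n ≤ length (outputsCode (outputs C)) + (G + (n + w))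
    copy₁ rewrite length-outputsCode (outputs C) = begin
      G + 23 * n + n            ≡⟨ arrange G n ⟩
      n + (G + (n + 22 * n))    ≤⟨ +-monoʳ-≤ n (+-monoʳ-≤ G (+-monoʳ-≤ n le)) ⟩
      n + (G + (n + w))         ∎
      where
      arrange : ∀ g n → g + 23 * n + n ≡ n + (g + (n + 22 * n))
      arrange = solve-∀
    copy₂ : G + 3 * n + n ≤ length (copyCode n (G + 23 * n)) + (length (outputsCode (outputs C)) + (G + (n + w)))
    copy₂ rewrite length-outputsCode (outputs C) | length-replicate n {orʳ (G + 23 * n + pred n) (G + 23 * n + pred n)} = begin
      G + 3 * n + n                ≡⟨ arrange G n ⟩
      n + (n + (G + (n + 1 * n)))  ≤⟨ +-monoʳ-≤ n (+-monoʳ-≤ n (+-monoʳ-≤ G (+-monoʳ-≤ n (≤-trans (*-monoˡ-≤ n {1} {22} (s≤s z≤n)) le)))) ⟩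
      n + (n + (G + (n + w)))      ∎
      where
      arrange : ∀ g n → g + 3 * n + n ≡ n + (n + (g + (n + 1 * n)))
      arrange = solve-∀

  inScope-codeUpTo : ∀ S s → 0 < n → s ≤ S → InScope (S * n) (codeUpTo s)
  inScope-codeUpTo S zero    n>0 s≤S = inScope-replicate (22 * n) (constʳ false) tt
  inScope-codeUpTo S (suc s) n>0 s<S =
    inScope-++ (codeUpTo s) _ (inScope-codeUpTo S s n>0 (<⇒≤ s<S))
      (inScope-++ (copyCode n (source s)) bodyCode (inScope-copy n (source s) source≤)
        (subst (λ l → InScope (l + (length (codeUpTo s) + S * n)) bodyCode) (sym (length-replicate n))
          (inScope-body n>0 wide)))
    where
    open ≤-Reasoning
    source≤ : source s + n ≤ length (codeUpTo s) + S * n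
    source≤ = begin
      source s + n                        ≡⟨ cong (_+ n) (source≡ s) ⟩
      length (codeUpTo s) + s * n + n     ≡⟨ +-assoc (length (codeUpTo s)) (s * n) n ⟩
      length (codeUpTo s) + (s * n + n)   ≡⟨ cong (length (codeUpTo s) +_) (+-comm (s * n) n) ⟩
      length (codeUpTo s) + suc s * n     ≤⟨ +-monoʳ-≤ (length (codeUpTo s)) (*-monoˡ-≤ n s<S) ⟩
      length (codeUpTo s) + S * n         ∎
    wide : 22 * n ≤ length (codeUpTo s) + S * n
    wide = ≤-trans (≤-trans (m≤m+n (22 * n) _) (≤-reflexive (sym (length-codeUpTo s)))) (m≤m+n _ _)

  exec-step : ∀ o ρ (h y : Block) (x : U n) → 0 < n →
              (∀ j → j < n → ρ j ≡ h j) → (∀ j → j < n → ρ (21 * n + j) ≡ y j) →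
              (∀ j → ρ (o + toℕ j) ≡ lookup x j) →
              ∃[ σ ] Models n (exec (stepCode o) ρ) (runOps n logic (h ◂ y ◂ bits (eval C x) ◂ σ))
  exec-step o ρ h y x n>0 ρh ρy ρx = σ , subst (λ ρ → Models n ρ (runOps n logic stack)) (sym unfold)
    (exec-ops n logic ρ₅ stack n>0 models)
    where
    ρ₁ = exec (copyCode n o) ρ
    ρ₂ = exec (raw (gates C)) ρ₁
    ρ₃ = exec (outputsCode (outputs C)) ρ₂
    ρ₄ = exec (copyCode n (G + 23 * n)) ρ₃
    ρ₅ = exec (copyCode n (G + 3 * n)) ρ₄
    -- All deeper blocks are read off the environment itself, so modelling them is trivial.
    σ : ℕ → Block
    σ k j = ρ₅ ((3 + k) * n + j)
    z = bits (eval C x)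
    stack = h ◂ y ◂ z ◂ σ
    unfold : exec (stepCode o) ρ ≡ exec (opsCode n logic) ρ₅
    unfold = trans (exec-++ (copyCode n o) _ ρ) (trans (exec-++ (raw (gates C)) _ ρ₁)
      (trans (exec-++ (outputsCode (outputs C)) _ ρ₂) (trans (exec-++ (copyCode n (G + 23 * n)) _ ρ₃)
        (exec-++ (copyCode n (G + 3 * n)) _ ρ₄))))
    ρ₁x : ∀ j → lookup x j ≡ ρ₁ (toℕ j)
    ρ₁x j = sym (trans (exec-copy n o ρ (toℕ j) (toℕ<n j)) (ρx j))
    ρ₃z : ∀ j → j < n → ρ₃ j ≡ z j
    ρ₃z j j<n = begin
      ρ₃ j                                                       ≡⟨ cong ρ₃ (toℕ-fromℕ< j<n) ⟨
      ρ₃ (toℕ i)                                                 ≡⟨ exec-outputs (outputs C) ρ₂ i ⟩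
      ρ₂ (toℕ (lookup (outputs C) i))                            ≡⟨ evalGates-raw (gates C) x ρ₁ ρ₁x _ ⟨
      lookup (evalGates (gates C) x) (lookup (outputs C) i)      ≡⟨ lookup-map i (lookup (evalGates (gates C) x)) (outputs C) ⟨
      lookup (eval C x) i                                        ≡⟨ nthOr-< false (eval C x) j<n ⟨
      z j                                                        ∎
      where
      open ≡-Reasoning
      i = fromℕ< j<n
    ρ₃-old : ∀ k → ρ₃ (n + (G + (n + k))) ≡ ρ k
    ρ₃-old k = trans (cong (λ l → ρ₃ (l + (G + (n + k)))) (sym (length-outputsCode (outputs C))))
      (trans (exec-old (outputsCode (outputs C)) ρ₂ (G + (n + k)))
        (trans (exec-old (raw (gates C)) ρ₁ (n + k)) (exec-replicate-old n _ ρ k)))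
    -- The block at depth 21 now lies behind the copied input, the `G` gates and the outputs of `C`,
    -- which makes 23 blocks besides `G`. For `h`, formerly at depth 0, the copy of `y` is a third
    -- block in front.
    ρ₄y : ∀ j → j < n → ρ₄ j ≡ y j
    ρ₄y j j<n = trans (exec-copy n (G + 23 * n) ρ₃ j j<n) (trans (cong ρ₃ (arrange G n j))
      (trans (ρ₃-old (21 * n + j)) (ρy j j<n)))
      where
      arrange : ∀ g n j → g + 23 * n + j ≡ n + (g + (n + (21 * n + j)))
      arrange = solve-∀
    ρ₄-old : ∀ k → ρ₄ (n + k) ≡ ρ₃ k
    ρ₄-old k = exec-replicate-old n _ ρ₃ k
    ρ₅-old : ∀ k → ρ₅ (n + k) ≡ ρ₄ k
    ρ₅-old k = exec-replicate-old n _ ρ₄ k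
    models : Models n ρ₅ stack
    models 0 j j<n = trans (exec-copy n (G + 3 * n) ρ₄ j j<n) (trans (cong ρ₄ (arrange G n j))
      (trans (ρ₄-old (n + (G + (n + j)))) (trans (ρ₃-old j) (ρh j j<n))))
      where
      arrange : ∀ g n j → g + 3 * n + j ≡ n + (n + (g + (n + j)))
      arrange = solve-∀
    models 1 j j<n = trans (cong ρ₅ (+-assoc n (0 * n) j)) (trans (ρ₅-old j) (ρ₄y j j<n))
    models 2 j j<n = trans (cong ρ₅ (trans (+-assoc n (1 * n) j) (cong (n +_) (+-assoc n (0 * n) j))))
      (trans (ρ₅-old (n + j)) (trans (ρ₄-old j) (ρ₃z j j<n)))
    models (suc (suc (suc k))) j j<n = refl

  module _ (x : ℕ → U n) (S : ℕ) (ρ : ℕ → Bool) (n>0 : 0 < n)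
           (ρx : ∀ s → s < S → ∀ j → ρ (s * n + toℕ j) ≡ lookup (x s) j) where

    private
      y : ℕ → Block
      y s = bits (eval C (x s))

      ρ′ : ℕ → ℕ → Bool
      ρ′ s = exec (codeUpTo s) ρ

      step : ∀ s h y₀ → s < S → (∀ j → j < n → ρ′ s j ≡ h j) → (∀ j → j < n → ρ′ s (21 * n + j) ≡ y₀ j) →
             ∃[ σ ] Models n (ρ′ (suc s)) (runOps n logic (h ◂ y₀ ◂ y s ◂ σ))
      step s h y₀ s<S ρh ρy
        rewrite exec-++ (codeUpTo s) (stepCode (source s)) ρ =
        exec-step (source s) (ρ′ s) h y₀ (x s) n>0 ρh ρy λ j →
          trans (cong (ρ′ s) (trans (cong (_+ toℕ j) (source≡ s)) (+-assoc (length (codeUpTo s)) (s * n) (toℕ j))))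
            (trans (exec-old (codeUpTo s) ρ (s * n + toℕ j)) (ρx s s<S j))

      zeros : ∀ c (ρ : ℕ → Bool) k → k < c → exec (replicate c (constʳ false)) ρ k ≡ false
      zeros (suc c) ρ zero    _         = exec-snoc c (constʳ false) ρ 0
      zeros (suc c) ρ (suc k) (s≤s k<c) = trans (exec-snoc c (constʳ false) ρ (suc k)) (zeros c ρ k k<c)

      -- Lets step 0 use the same code as the others: hole and previous value are both the zero
      -- block there, so either choice yields `H 0`.
      choose-zeros : ∀ b j → choose b (λ _ → false) (λ _ → false) j ≡ false
      choose-zeros false j = refl
      choose-zeros true  j = refl

      block< : ∀ k j → k < 22 → j < n → k * n + j < 22 * n
      block< k j k<22 j<n = ≤-trans (subst (_≤ suc k * n) (+-suc (k * n) j) (≤-trans (+-monoʳ-≤ (k * n) j<n) (≤-reflexive (+-comm (k * n) n))))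
        (*-monoˡ-≤ n k<22)

    exec-codeUpTo : ∀ i → i < S → (∀ j → j < n → ρ′ (suc i) j ≡ hole n y i j) ×
                                  (∀ j → j < n → ρ′ (suc i) (21 * n + j) ≡ y i j)
    exec-codeUpTo zero 0<S with step 0 (λ _ → false) (λ _ → false) 0<S
      (λ j j<n → zeros (22 * n) ρ j (block< 0 j (s≤s z≤n) j<n))
      (λ j j<n → zeros (22 * n) ρ (21 * n + j) (block< 21 j ≤-refl j<n))
    ... | σ , models = (λ j j<n → trans (models 0 j j<n) (choose-zeros (select n (λ _ → false) (λ _ → false) (y 0)) j)) , models 21
    exec-codeUpTo (suc i) i<S with exec-codeUpTo i (<⇒≤ i<S)
    ... | ρh , ρy with step (suc i) (hole n y i) (y i) i<S ρh ρy
    ... | σ , models = models 0 , models 21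

    exec-select : ∀ i → suc i < S → ρ′ (2 + i) (4 * n) ≡ select n (hole n y i) (y i) (y (suc i))
    exec-select i i<S with exec-codeUpTo i (<⇒≤ i<S)
    ... | ρh , ρy with step (suc i) (hole n y i) (y i) i<S ρh ρy
    ... | σ , models = trans (cong (ρ′ (2 + i)) (sym (+-identityʳ (4 * n)))) (models 4 0 n>0)

-- Constructing the predicates

encRaw : RawGate → Tree
encRaw (constʳ b) = encℕ 0 ∙ encBool b
encRaw (negʳ i)   = encℕ 1 ∙ encℕ i
encRaw (andʳ i j) = encℕ 2 ∙ encℕ i ∙ encℕ j
encRaw (orʳ i j)  = encℕ 3 ∙ encℕ i ∙ encℕ j

encCode : Code → Tree
encCode []       = nil
encCode (g ∷ gs) = encRaw g ∙ encCode gs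

encGate-raw : ∀ {w} (g : Gate w) → encGate g ≡ encRaw (rawGate g)
encGate-raw (const b) = refl
encGate-raw (neg i)   = refl
encGate-raw (and i j) = refl
encGate-raw (or i j)  = refl

encGates-raw : ∀ {w w′} (gs : Gates w w′) → encGates gs ≡ encCode (raw gs)
encGates-raw []       = refl
encGates-raw (g ∷ gs) = cong₂ _∙_ (encGate-raw g) (encGates-raw gs)

encCode-++ : ∀ gs hs → encCode (gs ++ hs) ≡ encCode gs ++ᵗ encCode hs
encCode-++ []       hs = refl
encCode-++ (g ∷ gs) hs = cong (encRaw g ∙_) (encCode-++ gs hs)

encCode-replicate : ∀ c g → encCode (replicate c g) ≡ repeatᵗ c (encRaw g)
encCode-replicate zero    g = refl
encCode-replicate (suc c) g = cong (encRaw g ∙_) (encCode-replicate c g)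

len-encCode : ∀ gs → len (encCode gs) ≡ length gs
len-encCode []       = refl
len-encCode (g ∷ gs) = cong suc (len-encCode gs)

infix 4 _at_is_

_at_is_ : FP → Tree → Tree → Set
p at z is v = fun p z ≡ v

numᶠ : ℕ → FP
numᶠ zero    = nilᶠ
numᶠ (suc k) = nilᶠ ∙ᶠ numᶠ k

module _ {z : Tree} where

  ++-is : ∀ {p q m k} → p at z is encℕ m → q at z is encℕ k → p ++ᶠ q at z is encℕ (m + k)
  ++-is {p} {q} {m} {k} hp hq = trans (fun-++ᶠ p q z) (trans (cong₂ _++ᵗ_ hp hq) (encℕ-+ m k))

  code-++-is : ∀ {p q gs hs} → p at z is encCode gs → q at z is encCode hs → p ++ᶠ q at z is encCode (gs ++ hs)
  code-++-is {p} {q} {gs} {hs} hp hq = trans (fun-++ᶠ p q z) (trans (cong₂ _++ᵗ_ hp hq) (sym (encCode-++ gs hs)))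

timesᶠ : ℕ → FP → FP
timesᶠ zero    p = nilᶠ
timesᶠ (suc k) p = p ++ᶠ timesᶠ k p

predᶠ : FP → FP
predᶠ p = p ⨾ᶠ tlᶠ

mulᶠ : FP → FP → FP
mulᶠ p q = repeatᶠ p q ⨾ᶠ concatᶠ

module _ {z : Tree} where

  times-is : ∀ k {p n} → p at z is encℕ n → timesᶠ k p at z is encℕ (k * n)
  times-is zero    hp = refl
  times-is (suc k) {p} {n} hp = ++-is {p = p} {timesᶠ k p} {n} {k * n} hp (times-is k hp)

  pred-is : ∀ {p n} → p at z is encℕ n → predᶠ p at z is encℕ (pred n)
  pred-is {n = n} hp = trans (cong right hp) (right-encℕ n)
    where
    right-encℕ : ∀ n → right (encℕ n) ≡ encℕ (pred n)
    right-encℕ zero    = refl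
    right-encℕ (suc n) = refl

  mul-is : ∀ {p q m k} → p at z is encℕ m → q at z is encℕ k → mulᶠ p q at z is encℕ (m * k)
  mul-is {p} {q} {m} {k} hp hq = begin
    fun (mulᶠ p q) z                              ≡⟨ fun-concatᶠ (fun (repeatᶠ p q) z) ⟩
    concatᵗ (fun (repeatᶠ p q) z)                 ≡⟨ cong concatᵗ (fun-repeatᶠ p q z) ⟩
    concatᵗ (repeatᵗ (len (fun p z)) (fun q z))   ≡⟨ cong₂ (λ l t → concatᵗ (repeatᵗ (len l) t)) hp hq ⟩
    concatᵗ (repeatᵗ (len (encℕ m)) (encℕ k))     ≡⟨ cong (λ l → concatᵗ (repeatᵗ l (encℕ k))) (len-encℕ m) ⟩
    concatᵗ (repeatᵗ m (encℕ k))                  ≡⟨ go m ⟩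
    encℕ (m * k)                                  ∎
    where
    open ≡-Reasoning
    go : ∀ m → concatᵗ (repeatᵗ m (encℕ k)) ≡ encℕ (m * k)
    go zero    = refl
    go (suc m) = trans (cong (encℕ k ++ᵗ_) (go m)) (encℕ-+ k (m * k))

  len-is : ∀ {p gs} → p at z is encCode gs → lenᶠ p at z is encℕ (length gs)
  len-is {p} {gs} hp = trans (fun-lenᶠ p z) (cong encℕ (trans (cong len hp) (len-encCode gs)))

  replicate-is : ∀ {p q n g} → p at z is encℕ n → q at z is encRaw g → repeatᶠ p q at z is encCode (replicate n g)
  replicate-is {p} {q} {n} {g} hp hq = begin
    fun (repeatᶠ p q) z                  ≡⟨ fun-repeatᶠ p q z ⟩
    repeatᵗ (len (fun p z)) (fun q z)    ≡⟨ cong₂ (λ l t → repeatᵗ (len l) t) hp hq ⟩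
    repeatᵗ (len (encℕ n)) (encRaw g)    ≡⟨ cong (λ l → repeatᵗ l (encRaw g)) (len-encℕ n) ⟩
    repeatᵗ n (encRaw g)                 ≡⟨ encCode-replicate n g ⟨
    encCode (replicate n g)              ∎
    where open ≡-Reasoning

module _ (N : FP) where

  lastᶠ : ℕ → FP
  lastᶠ k = timesᶠ k N ++ᶠ predᶠ N

  opᶠ : Op → FP
  opᶠ (notᵇ k)   = repeatᶠ N (numᶠ 1 ∙ᶠ lastᶠ k)
  opᶠ (andᵇ k l) = repeatᶠ N (numᶠ 2 ∙ᶠ lastᶠ k ∙ᶠ lastᶠ l)
  opᶠ (orᵇ k l)  = repeatᶠ N (numᶠ 3 ∙ᶠ lastᶠ k ∙ᶠ lastᶠ l)
  opᶠ (aboveᵇ k) = (numᶠ 0 ∙ᶠ nilᶠ) ∙ᶠ repeatᶠ (predᶠ N) (numᶠ 3 ∙ᶠ (nilᶠ ∙ᶠ lastᶠ k) ∙ᶠ nilᶠ)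
  opᶠ spreadᵇ    = repeatᶠ N (numᶠ 3 ∙ᶠ nilᶠ ∙ᶠ nilᶠ)

  opsᶠ : List Op → FP
  opsᶠ []         = nilᶠ
  opsᶠ (op ∷ ops) = opᶠ op ++ᶠ opsᶠ ops

  copyᶠ : FP → FP
  copyᶠ o = repeatᶠ N (numᶠ 3 ∙ᶠ (o ++ᶠ predᶠ N) ∙ᶠ (o ++ᶠ predᶠ N))

  module _ {z : Tree} {n : ℕ} (hN : N at z is encℕ n) where

    last-is : ∀ k → lastᶠ k at z is encℕ (k * n + pred n)
    last-is k = ++-is {p = timesᶠ k N} {predᶠ N} {k * n} {pred n} (times-is k {N} {n} hN) (pred-is {p = N} {n} hN)

    op-is : ∀ op → opᶠ op at z is encCode (opCode n op)
    op-is (notᵇ k)   = replicate-is {p = N} {numᶠ 1 ∙ᶠ lastᶠ k} {n} {negʳ _} hN (cong (encℕ 1 ∙_) (last-is k))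
    op-is (andᵇ k l) = replicate-is {p = N} {numᶠ 2 ∙ᶠ lastᶠ k ∙ᶠ lastᶠ l} {n} {andʳ _ _} hN
      (cong₂ (λ s t → encℕ 2 ∙ s ∙ t) (last-is k) (last-is l))
    op-is (orᵇ k l)  = replicate-is {p = N} {numᶠ 3 ∙ᶠ lastᶠ k ∙ᶠ lastᶠ l} {n} {orʳ _ _} hN
      (cong₂ (λ s t → encℕ 3 ∙ s ∙ t) (last-is k) (last-is l))
    op-is (aboveᵇ k) = cong ((nil ∙ nil) ∙_)
      (replicate-is {p = predᶠ N} {numᶠ 3 ∙ᶠ (nilᶠ ∙ᶠ lastᶠ k) ∙ᶠ nilᶠ} {pred n} {orʳ _ 0} (pred-is {p = N} {n} hN)
        (cong (λ s → encℕ 3 ∙ (nil ∙ s) ∙ nil) (last-is k)))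
    op-is spreadᵇ    = replicate-is {p = N} {numᶠ 3 ∙ᶠ nilᶠ ∙ᶠ nilᶠ} {n} {orʳ 0 0} hN refl

    ops-is : ∀ ops → opsᶠ ops at z is encCode (opsCode n ops)
    ops-is []         = refl
    ops-is (op ∷ ops) = code-++-is {p = opᶠ op} {opsᶠ ops} {opCode n op} {opsCode n ops} (op-is op) (ops-is ops)

    copy-is : ∀ {p o} → p at z is encℕ o → copyᶠ p at z is encCode (copyCode n o)
    copy-is {p} {o} hp = replicate-is {p = N} {numᶠ 3 ∙ᶠ (p ++ᶠ predᶠ N) ∙ᶠ (p ++ᶠ predᶠ N)} {n} {orʳ _ _} hN
      (cong (λ t → encℕ 3 ∙ t ∙ t) (++-is {p = p} {predᶠ N} {o} {pred n} hp (pred-is {p = N} {n} hN)))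

-- A scan lists the result for the shortest suffix first, which is the order of `outputsCode`; the
-- length of the rest supplies the shift.
outputsᶠ : FP → FP
outputsᶠ p = (nilᶠ ∙ᶠ p) ⨾ᶠ scanᶠ (numᶠ 3 ∙ᶠ index ∙ᶠ index)
  where
  index : FP
  index = (tlᶠ ⨾ᶠ hdᶠ) ++ᶠ lenᶠ (tlᶠ ⨾ᶠ tlᶠ)

len-encVec : ∀ {A : Set} {m} (enc : A → Tree) (v : Vec A m) → len (encVec enc v) ≡ m
len-encVec enc []       = refl
len-encVec enc (x ∷ xs) = cong suc (len-encVec enc xs)

outputs-is : ∀ {p z w o} (is : Vec (Fin w) o) → p at z is encVec encFin is → outputsᶠ p at z is encCode (outputsCode is)
outputs-is {p} {z} is hp = trans (cong (λ t → scan (fun gate) nil t nil) hp) (trans (go is nil) (++ᵗ-identityʳ _))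
  where
  index gate : FP
  index = (tlᶠ ⨾ᶠ hdᶠ) ++ᶠ lenᶠ (tlᶠ ⨾ᶠ tlᶠ)
  gate = numᶠ 3 ∙ᶠ index ∙ᶠ index
  index-is : ∀ {w o} (i : Fin w) (is : Vec (Fin w) o) → index at (nil ∙ encFin i ∙ encVec encFin is) is encℕ (toℕ i + o)
  index-is {o = o} i is = ++-is {z = nil ∙ encFin i ∙ encVec encFin is} {p = tlᶠ ⨾ᶠ hdᶠ} {lenᶠ (tlᶠ ⨾ᶠ tlᶠ)} {toℕ i} {o} refl
    (trans (fun-lenᶠ (tlᶠ ⨾ᶠ tlᶠ) (nil ∙ encFin i ∙ encVec encFin is)) (cong encℕ (len-encVec encFin is)))
  go : ∀ {w o} (is : Vec (Fin w) o) r → scan (fun gate) nil (encVec encFin is) r ≡ encCode (outputsCode is) ++ᵗ r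
  go []                   r = refl
  go {o = suc o} (i ∷ is) r = begin
    scan (fun gate) nil (encVec encFin is) (fun gate (nil ∙ encFin i ∙ encVec encFin is) ∙ r)
      ≡⟨ go is _ ⟩
    encCode (outputsCode is) ++ᵗ (fun gate (nil ∙ encFin i ∙ encVec encFin is) ∙ r)
      ≡⟨ cong (λ t → encCode (outputsCode is) ++ᵗ ((encℕ 3 ∙ t ∙ t) ∙ r)) (index-is i is) ⟩
    encCode (outputsCode is) ++ᵗ (encCode [ g ] ++ᵗ r)
      ≡⟨ ++ᵗ-assoc (encCode (outputsCode is)) (encCode [ g ]) r ⟨
    (encCode (outputsCode is) ++ᵗ encCode [ g ]) ++ᵗ r
      ≡⟨ cong (_++ᵗ r) (encCode-++ (outputsCode is) [ g ]) ⟨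
    encCode (outputsCode is ++ [ g ]) ++ᵗ r ∎
    where
    open ≡-Reasoning
    g = orʳ (toℕ i + o) (toℕ i + o)

module _ (N Gs Os : FP) where

  bodyᶠ : FP
  bodyᶠ = Gs ++ᶠ outputsᶠ Os ++ᶠ copyᶠ N (lenᶠ Gs ++ᶠ timesᶠ 23 N) ++ᶠ copyᶠ N (lenᶠ Gs ++ᶠ timesᶠ 3 N) ++ᶠ opsᶠ N logic

  body-is : ∀ {z n} (C : Circuit n n) → N at z is encℕ n → Gs at z is encCode (raw (gates C)) →
            Os at z is encVec encFin (outputs C) → bodyᶠ at z is encCode (bodyCode C)
  body-is {z} {n} C hN hG hO =
    code-++-is {p = Gs} {outputsᶠ Os ++ᶠ cy ++ᶠ ch ++ᶠ opsᶠ N logic} {raw (gates C)} hG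
      (code-++-is {p = outputsᶠ Os} {cy ++ᶠ ch ++ᶠ opsᶠ N logic} {outputsCode (outputs C)} (outputs-is {Os} (outputs C) hO)
        (code-++-is {p = cy} {ch ++ᶠ opsᶠ N logic} {copyCode n _} (copy-is N {n = n} hN {p = oy} (offset 23))
          (code-++-is {p = ch} {opsᶠ N logic} {copyCode n _} (copy-is N {n = n} hN {p = oh} (offset 3)) (ops-is N {n = n} hN logic))))
    where
    oy oh cy ch : FP
    oy = lenᶠ Gs ++ᶠ timesᶠ 23 N
    oh = lenᶠ Gs ++ᶠ timesᶠ 3 N
    cy = copyᶠ N oy
    ch = copyᶠ N oh
    offset : ∀ k → lenᶠ Gs ++ᶠ timesᶠ k N at z is encℕ (length (raw (gates C)) + k * n)
    offset k = ++-is {p = lenᶠ Gs} {timesᶠ k N} {_} {k * n} (len-is {p = Gs} {raw (gates C)} hG) (times-is k {N} {n} hN)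

-- The first argument of stepᶠ and circuitᶠ pairs n with the body; the index
-- of the step or of the predicate is the length of the rest of the list.
stepᶠ : FP
stepᶠ = copyᶠ N (timesᶠ 22 N ++ᶠ mulᶠ (tlᶠ ⨾ᶠ tlᶠ) (N ++ᶠ N ++ᶠ lenᶠ body)) ++ᶠ body
  where
  N body : FP
  N    = hdᶠ ⨾ᶠ hdᶠ
  body = hdᶠ ⨾ᶠ tlᶠ

circuitᶠ : FP
circuitᶠ = (repeatᶠ (timesᶠ 22 N) (numᶠ 0 ∙ᶠ nilᶠ) ++ᶠ ((hdᶠ ∙ᶠ (nilᶠ ∙ᶠ nilᶠ ∙ᶠ (tlᶠ ⨾ᶠ tlᶠ))) ⨾ᶠ scanᶠ stepᶠ ⨾ᶠ concatᶠ))
           ∙ᶠ timesᶠ 4 N ∙ᶠ nilᶠ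
  where
  N : FP
  N = hdᶠ ⨾ᶠ hdᶠ

instanceᶠ : FP
instanceᶠ = hdᶠ ∙ᶠ (((hdᶠ ∙ᶠ bodyᶠ hdᶠ (tlᶠ ⨾ᶠ hdᶠ) (tlᶠ ⨾ᶠ tlᶠ)) ∙ᶠ (hdᶠ ⨾ᶠ tlᶠ)) ⨾ᶠ scanᶠ circuitᶠ)

encVec-snoc : ∀ (c : ℕ → Tree) m r →
              encVec (λ t → t) (tabulate {n = m} λ i → c (toℕ i)) ++ᵗ (c m ∙ r) ≡
              encVec (λ t → t) (tabulate {n = suc m} λ i → c (toℕ i)) ++ᵗ r
encVec-snoc c zero    r = refl
encVec-snoc c (suc m) r = cong (c 0 ∙_) (encVec-snoc (λ k → c (suc k)) m r)

-- The shortest suffix has an empty rest and comes first, so the indices, which are the lengths of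
-- the rests, ascend from 0.
scan-tabulate : ∀ f e (c : ℕ → Tree) → (∀ k → f (e ∙ nil ∙ encℕ k) ≡ c k) → ∀ m r →
                scan f e (encℕ m) r ≡ encVec (λ t → t) (tabulate {n = m} λ i → c (toℕ i)) ++ᵗ r
scan-tabulate f e c eq zero    r = refl
scan-tabulate f e c eq (suc m) r rewrite eq m = trans (scan-tabulate f e c eq m (c m ∙ r)) (encVec-snoc c m r)

module _ {n} (C : Circuit n n) where

  private
    e : Tree
    e = encℕ n ∙ encCode (bodyCode C)

  step-is : ∀ s → stepᶠ at (e ∙ nil ∙ encℕ s) is encCode (stepCode C (source C s))
  step-is s = code-++-is {z = z} {copyᶠ N src} {body} {copyCode n (source C s)} {bodyCode C}
    (copy-is N {z} {n} refl {src} {source C s}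
      (++-is {z = z} {timesᶠ 22 N} {mulᶠ (tlᶠ ⨾ᶠ tlᶠ) stride} {22 * n} {s * (n + (n + L))}
        (times-is {z = z} 22 {N} {n} refl)
        (mul-is {z = z} {tlᶠ ⨾ᶠ tlᶠ} {stride} {s} {n + (n + L)} refl
          (++-is {z = z} {N} {N ++ᶠ lenᶠ body} {n} {n + L} refl
            (++-is {z = z} {N} {lenᶠ body} {n} {L} refl (len-is {z = z} {body} {bodyCode C} refl))))))
    refl
    where
    z = e ∙ nil ∙ encℕ s
    L = length (bodyCode C)
    N body stride src : FP
    N    = hdᶠ ⨾ᶠ hdᶠ
    body = hdᶠ ⨾ᶠ tlᶠ
    stride = N ++ᶠ N ++ᶠ lenᶠ body
    src = timesᶠ 22 N ++ᶠ mulᶠ (tlᶠ ⨾ᶠ tlᶠ) stride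

  scan-steps : ∀ s r → encCode (codeUpTo C 0) ++ᵗ concatᵗ (scan (fun stepᶠ) e (encℕ s) r) ≡
                       encCode (codeUpTo C s) ++ᵗ concatᵗ r
  scan-steps zero    r = refl
  scan-steps (suc s) r = begin
    encCode (codeUpTo C 0) ++ᵗ concatᵗ (scan (fun stepᶠ) e (encℕ s) (t ∙ r))   ≡⟨ scan-steps s (t ∙ r) ⟩
    encCode (codeUpTo C s) ++ᵗ (t ++ᵗ concatᵗ r)                               ≡⟨ ++ᵗ-assoc (encCode (codeUpTo C s)) t (concatᵗ r) ⟨
    (encCode (codeUpTo C s) ++ᵗ t) ++ᵗ concatᵗ r                               ≡⟨ cong (λ t → (encCode (codeUpTo C s) ++ᵗ t) ++ᵗ concatᵗ r) (step-is s) ⟩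
    (encCode (codeUpTo C s) ++ᵗ encCode code) ++ᵗ concatᵗ r                    ≡⟨ cong (_++ᵗ concatᵗ r) (encCode-++ (codeUpTo C s) code) ⟨
    encCode (codeUpTo C (suc s)) ++ᵗ concatᵗ r                                 ∎
    where
    open ≡-Reasoning
    t = fun stepᶠ (e ∙ nil ∙ encℕ s)
    code = stepCode C (source C s)

  encPredicate : ℕ → Tree
  encPredicate i = encCode (codeUpTo C (2 + i)) ∙ encℕ (4 * n) ∙ nil

  circuit-is : ∀ i → circuitᶠ at (e ∙ nil ∙ encℕ i) is encPredicate i
  circuit-is i = cong₂ (λ s t → s ∙ t ∙ nil) codes (times-is {z = z} 4 {N} {n} refl)
    where
    open ≡-Reasoning
    z = e ∙ nil ∙ encℕ i
    N zeros steps : FP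
    N = hdᶠ ⨾ᶠ hdᶠ
    zeros = repeatᶠ (timesᶠ 22 N) (numᶠ 0 ∙ᶠ nilᶠ)
    -- Predicate `i` has `2 + i` arguments and processes one per step: two entries are put in front
    -- of the `i` at hand.
    steps = (hdᶠ ∙ᶠ (nilᶠ ∙ᶠ nilᶠ ∙ᶠ (tlᶠ ⨾ᶠ tlᶠ))) ⨾ᶠ scanᶠ stepᶠ ⨾ᶠ concatᶠ
    codes : fun (zeros ++ᶠ steps) z ≡ encCode (codeUpTo C (2 + i))
    codes = begin
      fun (zeros ++ᶠ steps) z
        ≡⟨ fun-++ᶠ zeros steps z ⟩
      fun zeros z ++ᵗ fun steps z
        ≡⟨ cong₂ _++ᵗ_ (replicate-is {z = z} {timesᶠ 22 N} {numᶠ 0 ∙ᶠ nilᶠ} {22 * n} {constʳ false}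
                          (times-is {z = z} 22 {N} {n} refl) refl)
                       (fun-concatᶠ (scan (fun stepᶠ) e (encℕ (2 + i)) nil)) ⟩
      encCode (codeUpTo C 0) ++ᵗ concatᵗ (scan (fun stepᶠ) e (encℕ (2 + i)) nil)
        ≡⟨ scan-steps (2 + i) nil ⟩
      encCode (codeUpTo C (2 + i)) ++ᵗ nil
        ≡⟨ ++ᵗ-identityʳ _ ⟩
      encCode (codeUpTo C (2 + i)) ∎

  instance-is : instanceᶠ at (encℕ n ∙ encCircuit C) is
                (encℕ n ∙ encVec (λ t → t) (tabulate {n = n ∸ 1} λ i → encPredicate (toℕ i)))
  instance-is = cong (encℕ n ∙_) (begin
    scan (fun circuitᶠ) (encℕ n ∙ fun (bodyᶠ hdᶠ (tlᶠ ⨾ᶠ hdᶠ) (tlᶠ ⨾ᶠ tlᶠ)) z) (right (encℕ n)) nil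
      ≡⟨ cong₂ (λ b m → scan (fun circuitᶠ) (encℕ n ∙ b) m nil)
           (body-is hdᶠ (tlᶠ ⨾ᶠ hdᶠ) (tlᶠ ⨾ᶠ tlᶠ) {z} {n} C refl (encGates-raw (gates C)) refl)
           (pred-is {z = z} {hdᶠ} {n} refl) ⟩
    scan (fun circuitᶠ) e (encℕ (pred n)) nil
      ≡⟨ scan-tabulate (fun circuitᶠ) e encPredicate circuit-is (pred n) nil ⟩
    encVec (λ t → t) (tabulate {n = pred n} λ i → encPredicate (toℕ i)) ++ᵗ nil
      ≡⟨ ++ᵗ-identityʳ _ ⟩
    encVec (λ t → t) (tabulate {n = pred n} λ i → encPredicate (toℕ i))
      ≡⟨ cong (λ m → encVec (λ t → t) (tabulate {n = m} λ i → encPredicate (toℕ i))) (pred≡∸1 n) ⟩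
    encVec (λ t → t) (tabulate {n = n ∸ 1} λ i → encPredicate (toℕ i)) ∎)
    where
    open ≡-Reasoning
    z = encℕ n ∙ encCircuit C
    pred≡∸1 : ∀ n → pred n ≡ n ∸ 1
    pred≡∸1 zero    = refl
    pred≡∸1 (suc n) = refl

-- The reduction

positive : ∀ {n} → Fin (n ∸ 1) → 0 < n
positive {suc n} i = s≤s z≤n

index+2≤ : ∀ {n} (i : Fin (n ∸ 1)) → 2 + toℕ i ≤ n
index+2≤ {suc n} i = s≤s (toℕ<n i)

module _ {n : ℕ} (C : Circuit n n) where

  private
    zeros : ∀ s → 22 * n ≤ length (codeUpTo C s)
    zeros s = ≤-trans (m≤m+n (22 * n) _) (≤-reflexive (sym (length-codeUpTo C s)))

    output< : ∀ (i : Fin (n ∸ 1)) → 4 * n < wiresAfter ((2 + toℕ i) * n) (codeUpTo C (2 + toℕ i))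
    output< i rewrite wiresAfter≡ ((2 + toℕ i) * n) (codeUpTo C (2 + toℕ i)) =
      <-≤-trans (*-monoˡ-< n {{>-nonZero (positive i)}} {4} {22} (s≤s (s≤s (s≤s (s≤s (s≤s z≤n))))))
        (≤-trans (zeros (2 + toℕ i)) (m≤m+n _ _))

    scoped : ∀ (i : Fin (n ∸ 1)) → InScope ((2 + toℕ i) * n) (codeUpTo C (2 + toℕ i))
    scoped i = inScope-codeUpTo C (2 + toℕ i) (2 + toℕ i) (positive i) ≤-refl

  -- The last of the `2 + i` steps treats the final argument as the successor of `a_i`. Its `select`
  -- block lies at depth 4, and wire `4 * n` is the first bit of that block.
  predicates : Predicates n
  predicates i = circuit (toGates (codeUpTo C (2 + toℕ i)) (scoped i)) (fromℕ< (output< i) ∷ [])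

  enc-predicates : ∀ i → encCircuit (predicates i) ≡ encPredicate C (toℕ i)
  enc-predicates i = cong₂ (λ s t → s ∙ t ∙ nil)
    (trans (encGates-raw (toGates (codeUpTo C (2 + toℕ i)) (scoped i))) (cong encCode (raw-toGates (codeUpTo C (2 + toℕ i)) (scoped i))))
    (cong encℕ (toℕ-fromℕ< (output< i)))

  predicates-size : ∀ i → circuitSize (predicates i) ≡ 22 * n + (2 + toℕ i) * (n + (circuitSize C + 22 * n))
  predicates-size i = begin
    gateCount gs                                              ≡⟨ length-raw gs ⟨
    length (raw gs)                                           ≡⟨ cong length (raw-toGates (codeUpTo C (2 + toℕ i)) (scoped i)) ⟩
    length (codeUpTo C (2 + toℕ i))                           ≡⟨ length-codeUpTo C (2 + toℕ i) ⟩
    22 * n + (2 + toℕ i) * (n + length (bodyCode C))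
      ≡⟨ cong (λ l → 22 * n + (2 + toℕ i) * (n + l))
           (trans (length-bodyCode C (positive i)) (cong (_+ 22 * n) (length-raw (gates C)))) ⟩
    22 * n + (2 + toℕ i) * (n + (circuitSize C + 22 * n))     ∎
    where
    open ≡-Reasoning
    gs = toGates (codeUpTo C (2 + toℕ i)) (scoped i)

  zeroU : U n
  zeroU = Vec.replicate n false

  values : ∀ {m} → Vec (U n) m → ℕ → Block
  values a s = bits (eval C (nthOr zeroU a s))

  eval-predicates : ∀ i (xs : Vec (U n) (2 + toℕ i)) →
                    head (eval (predicates i) (concat xs)) ≡
                    select n (hole n (values xs) (toℕ i)) (values xs (toℕ i)) (values xs (suc (toℕ i)))
  eval-predicates i xs = begin
    lookup (evalGates gs (concat xs)) (fromℕ< (output< i))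
      ≡⟨ evalGates-raw gs (concat xs) ρ (λ k → sym (nthOr-lookup false (concat xs) k)) (fromℕ< (output< i)) ⟩
    exec (raw gs) ρ (toℕ (fromℕ< (output< i)))
      ≡⟨ cong₂ (λ c k → exec c ρ k) (raw-toGates (codeUpTo C (2 + toℕ i)) (scoped i)) (toℕ-fromℕ< (output< i)) ⟩
    exec (codeUpTo C (2 + toℕ i)) ρ (4 * n)
      ≡⟨ exec-select C (nthOr zeroU xs) (2 + toℕ i) ρ (positive i) (λ s s< j → block xs s s< j) (toℕ i) ≤-refl ⟩
    select n (hole n (values xs) (toℕ i)) (values xs (toℕ i)) (values xs (suc (toℕ i))) ∎
    where
    open ≡-Reasoning
    gs = toGates (codeUpTo C (2 + toℕ i)) (scoped i)
    ρ = bits (concat xs)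
    left-part : ∀ {m k} (x : U m) (v : U k) j → bits (x Vec.++ v) (toℕ j) ≡ lookup x j
    left-part (b ∷ x) v zero    = refl
    left-part (b ∷ x) v (suc j) = left-part x v j
    right-part : ∀ {m k} (x : U m) (v : U k) l → bits (x Vec.++ v) (m + l) ≡ bits v l
    right-part []      v l = refl
    right-part (b ∷ x) v l = right-part x v l
    block : ∀ {m} (xs : Vec (U n) m) s → s < m → ∀ j → bits (concat xs) (s * n + toℕ j) ≡ lookup (nthOr zeroU xs s) j
    block (x ∷ xs) zero    _        j = left-part x (concat xs) j
    block (x ∷ xs) (suc s) (s≤s s<) j =
      trans (cong (bits (x Vec.++ concat xs)) (+-assoc n (s * n) (toℕ j)))
        (trans (right-part x (concat xs) (s * n + toℕ j)) (block xs s s< j))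

nthOr-truncate : ∀ {A : Set} d {m n} (le : m ≤ n) (v : Vec A n) s → s < m → nthOr d (truncate le v) s ≡ nthOr d v s
nthOr-truncate d (s≤s le) (x ∷ v) zero    _        = refl
nthOr-truncate d (s≤s le) (x ∷ v) (suc s) (s≤s s<) = nthOr-truncate d le v s s<

nthOr-∷ʳ : ∀ {A : Set} d {m} (v : Vec A m) x s → s < m → nthOr d (v ∷ʳ x) s ≡ nthOr d v s
nthOr-∷ʳ d (y ∷ v) x zero    _        = refl
nthOr-∷ʳ d (y ∷ v) x (suc s) (s≤s s<) = nthOr-∷ʳ d v x s s<

nthOr-last : ∀ {A : Set} d {m} (v : Vec A m) x → nthOr d (v ∷ʳ x) m ≡ x
nthOr-last d []      x = refl
nthOr-last d (y ∷ v) x = nthOr-last d v x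

-- The argument list of a predicate has `a_j` in place of `a_(i+1)`. The hole at `i` looks no
-- further than `y i`, so it is the same for every `j`.
hole-cong : ∀ n y y′ i → (∀ s → s ≤ i → y s ≡ y′ s) → hole n y i ≡ hole n y′ i
hole-cong n y y′ zero    eq = refl
hole-cong n y y′ (suc i) eq = begin
  choose (select n (hole n y i) (y i) (y (suc i))) (hole n y i) (y i)
    ≡⟨ cong₂ (λ h z → choose (select n h (y i) z) h (y i)) (hole-cong n y y′ i (λ s s≤i → eq s (m≤n⇒m≤1+n s≤i))) (eq (suc i) ≤-refl) ⟩
  choose (select n (hole n y′ i) (y i) (y′ (suc i))) (hole n y′ i) (y i)
    ≡⟨ cong (λ z → choose (select n (hole n y′ i) z (y′ (suc i))) (hole n y′ i) z) (eq i (n≤1+n i)) ⟩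
  choose (select n (hole n y′ i) (y′ i) (y′ (suc i))) (hole n y′ i) (y′ i) ∎
  where open ≡-Reasoning

module _ {n : ℕ} (C : Circuit n n) (a : Vec (U n) (suc n)) where

  private
    d = zeroU C
    y = values C a

  valueAt-select : ∀ i j → valueAt (predicates C) a i j ≡ select n (hole n y (toℕ i)) (y (toℕ i)) (y (toℕ j))
  valueAt-select i j = begin
    valueAt (predicates C) a i j
      ≡⟨ eval-predicates C i xs ⟩
    select n (hole n y′ (toℕ i)) (y′ (toℕ i)) (y′ (suc (toℕ i)))
      ≡⟨ cong₂ (λ h z → select n h z (y′ (suc (toℕ i)))) (hole-cong n y′ y (toℕ i) earlier) (earlier (toℕ i) ≤-refl) ⟩
    select n (hole n y (toℕ i)) (y (toℕ i)) (y′ (suc (toℕ i)))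
      ≡⟨ cong (λ x → select n (hole n y (toℕ i)) (y (toℕ i)) (bits (eval C x)))
           (trans (nthOr-last d (prefix a i) (lookup a j)) (sym (nthOr-lookup d a j))) ⟩
    select n (hole n y (toℕ i)) (y (toℕ i)) (y (toℕ j)) ∎
    where
    open ≡-Reasoning
    xs = prefix a i ∷ʳ lookup a j
    y′ = values C xs
    earlier : ∀ s → s ≤ toℕ i → y′ s ≡ y s
    earlier s s≤i = cong (λ x → bits (eval C x))
      (trans (nthOr-∷ʳ d (prefix a i) (lookup a j) s (s≤s s≤i)) (nthOr-truncate d (≤-trans (toℕ<n i) (≤-trans (m∸n≤m n 1) (n≤1+n n))) a s (s≤s s≤i)))

  private
    at-index : ∀ j (j<n : j < suc n) → nthOr d a j ≡ lookup a (fromℕ< j<n)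
    at-index j j<n = nthOr-< d a j<n

    bits-ext : ∀ (x x′ : U n) → (∀ k → k < n → bits x k ≡ bits x′ k) → x ≡ x′
    bits-ext x x′ eq = vec-ext λ k →
      trans (sym (nthOr-lookup false x k)) (trans (eq (toℕ k) (toℕ<n k)) (nthOr-lookup false x′ k))

  long-choice⇒¬distinct : LongChoiceSolution (predicates C) a →
    ¬ ((∀ j → eval C (lookup a j) ≢ Vec.replicate n false) ×
       (∀ j k → toℕ j < toℕ k → eval C (lookup a j) ≢ eval C (lookup a k)))
  long-choice⇒¬distinct (_ , constant) (nonzero , distinct) = no-long-choice n y nonzero′ distinct′ constant′
    where
    nonzero′ : ∀ j → j ≤ n → ¬ (∀ k → k < n → y j k ≡ false)
    nonzero′ j j≤n eq = nonzero (fromℕ< (s≤s j≤n)) (trans (cong (eval C) (sym (at-index j (s≤s j≤n))))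
      (bits-ext (eval C (nthOr d a j)) (Vec.replicate n false) λ k k<n →
        trans (eq k k<n) (sym (trans (nthOr-< false (Vec.replicate n false) k<n) (lookup-replicate (fromℕ< k<n) false)))))
    distinct′ : ∀ i j → i < j → j ≤ n → ¬ (∀ k → k < n → y i k ≡ y j k)
    distinct′ i j i<j j≤n eq = distinct (fromℕ< i<) (fromℕ< (s≤s j≤n))
      (subst₂ _<_ (sym (toℕ-fromℕ< i<)) (sym (toℕ-fromℕ< (s≤s j≤n))) i<j)
      (subst₂ (λ x x′ → eval C x ≡ eval C x′) (at-index i i<) (at-index j (s≤s j≤n)) (bits-ext _ _ eq))
      where
      i< : i < suc n
      i< = s≤s (≤-trans (<⇒≤ i<j) j≤n)
    constant′ : ∀ i j j′ → suc i < n → i < j → i < j′ → j ≤ n → j′ ≤ n →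
                select n (hole n y i) (y i) (y j) ≡ select n (hole n y i) (y i) (y j′)
    constant′ i j j′ i+1<n i<j i<j′ j≤n j′≤n =
      trans (sym (value j (s≤s j≤n))) (trans (constant ι (fromℕ< (s≤s j≤n)) (fromℕ< (s≤s j′≤n)) (after (s≤s j≤n) i<j) (after (s≤s j′≤n) i<j′))
        (value j′ (s≤s j′≤n)))
      where
      i< : i < n ∸ 1
      i< = ∸-monoˡ-≤ 1 i+1<n
      ι = fromℕ< i<
      ι≡ = toℕ-fromℕ< i<
      after : ∀ {j} (j< : j < suc n) → i < j → toℕ ι < toℕ (fromℕ< j<)
      after j< i<j = subst₂ _<_ (sym ι≡) (sym (toℕ-fromℕ< j<)) i<j
      value : ∀ j (j< : j < suc n) → valueAt (predicates C) a ι (fromℕ< j<) ≡ select n (hole n y i) (y i) (y j)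
      value j j< = trans (valueAt-select ι (fromℕ< j<))
        (cong₂ (λ i j → select n (hole n y i) (y i) (y j)) ι≡ (toℕ-fromℕ< j<))

-- The existence of a predicate gives `n ≥ 2`, so powers of `n` absorb constants: `n ^ k` takes the
-- summand `k`, and `n ^ 7` the coefficient 47. The remaining two factors in the exponent 9 come
-- from the number of steps and from the length of a block.
predicates-small : ∀ k {n} (C : Circuit n n) → circuitSize C ≤ n ^ k + k → ∀ i →
                   circuitSize (predicates C i) ≤ n ^ (k + 9) + (k + 9)
predicates-small k {n} C small i = begin
  circuitSize (predicates C i)                        ≡⟨ predicates-size C i ⟩
  22 * n + (2 + toℕ i) * (n + (G + 22 * n))           ≤⟨ +-mono-≤ (*-monoʳ-≤ 22 n≤n*n)
                                                         (*-mono-≤ (index+2≤ {n} i) (+-monoʳ-≤ n (+-monoˡ-≤ (22 * n) G≤))) ⟩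
  22 * (n * n) + n * (n + (n ^ k + n ^ k + 22 * n))   ≡⟨ collect n (n ^ k) ⟩
  45 * (n * n) + 2 * (n * n ^ k)                      ≤⟨ +-mono-≤ (*-monoʳ-≤ 45 (*-monoʳ-≤ n (m≤m*n n (n ^ k))))
                                                         (*-monoʳ-≤ 2 (*-monoʳ-≤ n (m≤n*m (n ^ k) n))) ⟩
  45 * (n * (n * n ^ k)) + 2 * (n * (n * n ^ k))      ≡⟨ *-distribʳ-+ (n * (n * n ^ k)) 45 2 ⟨
  -- 47 + 81 = 128 = 2 ^ 7.
  47 * (n * (n * n ^ k))                              ≤⟨ *-monoˡ-≤ (n * (n * n ^ k)) (≤-trans (m≤m+n 47 81) (^-monoˡ-≤ 7 2≤n)) ⟩
  n ^ 7 * (n * (n * n ^ k))                           ≡⟨ cong (n ^ 7 *_) (*-assoc n n (n ^ k)) ⟨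
  n ^ 7 * (n * n * n ^ k)                             ≡⟨ *-assoc (n ^ 7) (n * n) (n ^ k) ⟨
  n ^ 7 * (n * n) * n ^ k                             ≡⟨ cong (λ m → n ^ 7 * (n * m) * n ^ k) (*-identityʳ n) ⟨
  n ^ 7 * n ^ 2 * n ^ k                               ≡⟨ cong (_* n ^ k) (^-distribˡ-+-* n 7 2) ⟨
  n ^ 9 * n ^ k                                       ≡⟨ ^-distribˡ-+-* n 9 k ⟨
  n ^ (9 + k)                                         ≡⟨ cong (n ^_) (+-comm 9 k) ⟩
  n ^ (k + 9)                                         ≤⟨ m≤m+n _ _ ⟩
  n ^ (k + 9) + (k + 9)                               ∎
  where
  open ≤-Reasoning
  G = circuitSize C
  2≤n : 2 ≤ n
  2≤n = ≤-trans (m≤m+n 2 (toℕ i)) (index+2≤ {n} i)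
  instance
    n-nonZero : NonZero n
    n-nonZero = >-nonZero (positive i)
    n^k-nonZero : NonZero (n ^ k)
    n^k-nonZero = m^n≢0 n k
  n≤n*n : n ≤ n * n
  n≤n*n = m≤m*n n n
  k≤2^k : ∀ k → k ≤ 2 ^ k
  k≤2^k zero    = z≤n
  k≤2^k (suc k) = ≤-trans (+-mono-≤ (m^n>0 2 k) (k≤2^k k)) (≤-reflexive (cong (2 ^ k +_) (sym (+-identityʳ (2 ^ k)))))
  G≤ : G ≤ n ^ k + n ^ k
  G≤ = ≤-trans small (+-monoʳ-≤ (n ^ k) (≤-trans (k≤2^k k) (^-monoˡ-≤ k 2≤n)))
  collect : ∀ n p → 22 * (n * n) + n * (n + (p + p + 22 * n)) ≡ 45 * (n * n) + 2 * (n * p)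
  collect = solve-∀

theorem2 : PPP-Hard LongChoice
theorem2 k = k + 9 , record
  { f       = reduced
  ; g       = λ I a → proj₁ (extracted I a)
  ; f-poly  = FP⇒PolyTime instanceᶠ λ I →
                trans (instance-is (C I)) (cong (λ ts → encℕ (n I) ∙ encVec (λ t → t) ts)
                  (tabulate-cong λ i → sym (enc-predicates (C I) i)))
  ; g-poly  = FP⇒PolyTime extractᶠ λ (I , a) → proj₁ (proj₂ (extracted I a))
  ; correct = λ I a → proj₂ (proj₂ (extracted I a))
  }
  where
  open CollisionInstance
  reduced : CollisionInstance k → LongChoiceInstance (k + 9)
  reduced I = record { n = n I ; P = predicates (C I) ; small = predicates-small k (C I) (small I) }
  extracted : ∀ I a → Sound (C I) (LongChoiceSolution (predicates (C I)) a) (fun extractᶠ ((encℕ (n I) ∙ encCircuit (C I)) ∙ encVec encU a))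
  extracted I a = extract-spec (C I) (LongChoiceSolution (predicates (C I)) a) (encℕ (n I)) a proj₁ (long-choice⇒¬distinct (C I) a)
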